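{- Let $\mathcal{B}$ be any (finite or infinite) structure on a finite signature. If there does not exist $\phi$ that breaks $\wedge$ on $\mathcal{B}$, and there does not exist $\psi$ that breaks $\vee$ on $\mathcal{B}$, then $\mathrm{MC}(\mathcal{B})$ is in Logspace.
   Context: Structures are relational with nonempty domain. A positive equality-free formula is a first-order formula built from relational atoms of the signature (the equality symbol is not available unless it is one of the relations) using only $\forall,\exists,\wedge,\vee$. For a fixed structure $\mathcal{B}$, $\mathrm{MC}(\mathcal{B})$ is the decision problem: given as input a positive equality-free sentence $\theta$ over the signature of $\mathcal{B}$, decide whether $\mathcal{B}\models\theta$; $\mathcal{B}$ is fixed and not part of the input, and one only asks for existence of a logarithmic-space algorithm for each $\mathcal{B}$. The input sentence may be assumed to be in prenex form. A positive equality-free sentence $\phi = Q_1v_1\ldots Q_kv_k\,(\phi_1\wedge\phi_2)$, with $Q_i\in\{\forall,\exists\}$ and $\phi_1,\phi_2$ positive equality-free formulas (not necessarily quantifier-free), breaks $\wedge$ on $\mathcal{B}$ if $\mathcal{B}\not\models\phi$ but $\mathcal{B}\models Q_1v_1\ldots Q_kv_k\,\phi_1$ and $\mathcal{B}\models Q_1v_1\ldots Q_kv_k\,\phi_2$. A positive equality-free sentence $\psi = Q'_1w_1\ldots Q'_\ell w_\ell\,(\psi_1\vee\psi_2)$ breaks $\vee$ on $\mathcal{B}$ if $\mathcal{B}\models\psi$ but $\mathcal{B}\not\models Q'_1w_1\ldots Q'_\ell w_\ell\,\psi_1$ and $\mathcal{B}\not\models Q'_1w_1\ldots Q'_\ell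 w_\ell\,\psi_2$. -}

module Defs where

open import Level using (Level; 0ℓ) renaming (suc to lsuc; _⊔_ to _⊔ˡ_)
open import Data.Bool.Base using (Bool)
open import Data.Fin.Base using (Fin; toℕ)
open import Data.List.Base using (List; []; _∷_; _++_; length; replicate)
open import Data.Nat.Base using (ℕ; zero; suc; pred; _+_; _*_; _≤_; _⊓_)
open import Data.Nat.Logarithm using (⌈log₂_⌉)
open import Data.Product.Base using (Σ-syntax; ∃-syntax; _×_; _,_)
open import Data.Sum.Base using (_⊎_; inj₁; inj₂)
import Data.Vec.Base as Vec
open Vec using (Vec; []; _∷_)
open import Function.Bundles using (_↔_)
open import Relation.Binary.Construct.Closure.ReflexiveTransitive using (Star)
open import Relation.Binary.PropositionalEquality using (_≡_)
open import Relation.Nullary.Negation using (¬_)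
open import Relation.Nullary.Reflects using (Reflects)
open import Relation.Unary using (Pred)

------------------------------------------------------------------------
-- Relational structures over a finite signature

record Signature : Set where
  field
    size  : ℕ
    arity : Fin size → ℕ

  RelSymbol : Set
  RelSymbol = Fin size

open Signature public

record Structure (S : Signature) (ℓ : Level) : Set (lsuc ℓ) where
  field
    Domain   : Set ℓ
    nonempty : Domain
    rel      : (R : RelSymbol S) → Vec Domain (arity S R) → Set ℓ

open Structure public

------------------------------------------------------------------------
-- Positive equality-free formulas

data Quantifier : Set where
  ∀Q ∃Q : Quantifier

infixr 7 _∧_
infixr 6 _∨_

-- `Formula S n` has its free variables among n de Bruijn variables;
-- variable 0 belongs to the innermost enclosing quantifier.
data Formula (S : Signature) (n : ℕ) : Set where
  atom  : (R : RelSymbol S) → Vec (Fin n) (arity S R) → Formula S n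
  _∧_   : Formula S n → Formula S n → Formula S n
  _∨_   : Formula S n → Formula S n → Formula S n
  quant : Quantifier → Formula S (suc n) → Formula S n

Sentence : Signature → Set
Sentence S = Formula S 0

-- The head of the vector is the innermost quantifier: with k = 2,
-- `prefix (Q₂ ∷ Q₁ ∷ []) φ` is Q₁v₁ Q₂v₂ φ.
prefix : ∀ {S k} → Vec Quantifier k → Formula S k → Sentence S
prefix []       φ = φ
prefix (Q ∷ Qs) φ = prefix Qs (quant Q φ)

module _ {S : Signature} {ℓ : Level} (B : Structure S ℓ) where

  Sat : ∀ {n} → Vec (Domain B) n → Formula S n → Set ℓ
  Sat ρ (atom R xs)  = rel B R (Vec.map (Vec.lookup ρ) xs)
  Sat ρ (φ ∧ ψ)      = Sat ρ φ × Sat ρ ψ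
  Sat ρ (φ ∨ ψ)      = Sat ρ φ ⊎ Sat ρ ψ
  Sat ρ (quant ∀Q φ) = (b : Domain B) → Sat (b ∷ ρ) φ
  Sat ρ (quant ∃Q φ) = Σ[ b ∈ Domain B ] Sat (b ∷ ρ) φ

infix 4 _⊨_

_⊨_ : ∀ {S ℓ} → Structure S ℓ → Sentence S → Set ℓ
B ⊨ φ = Sat B [] φ

Breaks∧ : ∀ {S ℓ} → Structure S ℓ → Sentence S → Set ℓ
Breaks∧ {S} B φ =
  ∃[ k ] Σ[ Qs ∈ Vec Quantifier k ] Σ[ φ₁ ∈ Formula S k ] Σ[ φ₂ ∈ Formula S k ]
    (φ ≡ prefix Qs (φ₁ ∧ φ₂)) ×
    (¬ (B ⊨ φ)) × (B ⊨ prefix Qs φ₁) × (B ⊨ prefix Qs φ₂)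

Breaks∨ : ∀ {S ℓ} → Structure S ℓ → Sentence S → Set ℓ
Breaks∨ {S} B ψ =
  ∃[ k ] Σ[ Qs ∈ Vec Quantifier k ] Σ[ ψ₁ ∈ Formula S k ] Σ[ ψ₂ ∈ Formula S k ]
    (ψ ≡ prefix Qs (ψ₁ ∨ ψ₂)) ×
    (B ⊨ ψ) × (¬ (B ⊨ prefix Qs ψ₁)) × (¬ (B ⊨ prefix Qs ψ₂))

------------------------------------------------------------------------
-- Deterministic Turing machines with a two-way read-only input tape and
-- a fixed number of two-way infinite work tapes

Finite : Set → Set
Finite A = ∃[ n ] (A ↔ Fin n)

data Move : Set where
  left stay right : Move

-- The input word is delimited by the endmarkers ⊢ and ⊣.
data InputCell (A : Set) : Set where
  ⊢   : InputCell A
  sym : A → InputCell A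
  ⊣   : InputCell A

record TM (A : Set) : Set₁ where
  field
    State        : Set
    Work         : Set
    #tapes       : ℕ
    inputFinite  : Finite A
    stateFinite  : Finite State
    workFinite   : Finite Work
    start        : State
    blank        : Work
    -- `inj₁ b` halts with verdict b; `inj₂` gives the next state, the move
    -- of the input head, and the symbol written and move made on each work
    -- tape.
    δ : State → InputCell A → Vec Work #tapes →
        Bool ⊎ (State × Move × Vec (Work × Move) #tapes)

-- A work tape restricted to the cells visited so far, which form an
-- interval around the head. `before` lists the cells to the left of the
-- head, nearest first.
record Tape (W : Set) : Set where
  constructor tape
  field
    before : List W
    head   : W
    after  : List W

visited : ∀ {W} → Tape W → ℕ
visited (tape ls _ rs) = length ls + suc (length rs)

moveTape : ∀ {W} → W → Move → Tape W → Tape W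
moveTape _ stay  t                    = t
moveTape b left  (tape []       x rs) = tape [] b (x ∷ rs)
moveTape _ left  (tape (l ∷ ls) x rs) = tape ls l (x ∷ rs)
moveTape b right (tape ls x [])       = tape (x ∷ ls) b []
moveTape _ right (tape ls x (r ∷ rs)) = tape (x ∷ ls) r rs

writeMove : ∀ {W} → W → W × Move → Tape W → Tape W
writeMove b (x , m) (tape ls _ rs) = moveTape b m (tape ls x rs)

-- The input head ranges over positions 0 (the cell ⊢) to suc (length w)
-- (the cell ⊣) and stays put when told to leave this range.
readInput : ∀ {A} → List A → ℕ → InputCell A
readInput {A} w zero    = ⊢
readInput {A} w (suc i) = go w i
  where
  go : List A → ℕ → InputCell A
  go []      _       = ⊣
  go (a ∷ _) zero    = sym a
  go (_ ∷ w) (suc i) = go w i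

moveInput : ∀ {A : Set} → List A → Move → ℕ → ℕ
moveInput w left  p = pred p
moveInput w stay  p = p
moveInput w right p = suc p ⊓ suc (length w)

module Run {A : Set} (M : TM A) where
  open TM M

  record Config : Set where
    constructor config
    field
      state    : State
      inputPos : ℕ
      tapes    : Vec (Tape Work) #tapes

  initial : Config
  initial = config start 0 (Vec.replicate #tapes (tape [] blank []))

  step : List A → Config → Bool ⊎ Config
  step w (config q p ts) with δ q (readInput w p) (Vec.map Tape.head ts)
  ... | inj₁ b             = inj₁ b
  ... | inj₂ (q′ , m , as) =
    inj₂ (config q′ (moveInput w m p) (Vec.zipWith (writeMove blank) as ts))

  Reachable : List A → Config → Set
  Reachable w = Star (λ c d → step w c ≡ inj₂ d) initial

  Outputs : List A → Bool → Set
  Outputs w b = ∃[ c ] Reachable w c × step w c ≡ inj₁ b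

  space : Config → ℕ
  space c = Vec.sum (Vec.map visited (Config.tapes c))

Decides : ∀ {A ℓ} → TM A → Pred (List A) ℓ → Set ℓ
Decides M L = ∀ w → ∃[ b ] Run.Outputs M w b × Reflects (L w) b

RunsInLogspace : ∀ {A} → TM A → Set
RunsInLogspace M =
  ∃[ c ] ∀ w κ → Run.Reachable M w κ →
    Run.space M κ ≤ c * suc ⌈log₂ length w ⌉

InLogspace : ∀ {A ℓ} → Pred (List A) ℓ → Set (lsuc 0ℓ ⊔ˡ ℓ)
InLogspace {A} L = Σ[ M ∈ TM A ] Decides M L × RunsInLogspace M

------------------------------------------------------------------------
-- The model checking problem, as a language

data Symbol (S : Signature) : Set where
  and or      : Symbol S
  quantifier  : Quantifier → Symbol S
  relation    : RelSymbol S → Symbol S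
  stroke stop : Symbol S

-- Variables are written in unary. A de Bruijn index is smaller than the
-- number of quantifiers in the sentence, so compared with binary indices
-- this lengthens the input at most quadratically, which changes the
-- logarithm of its length by a constant factor only.
encodeVars : ∀ {S n k} → Vec (Fin n) k → List (Symbol S)
encodeVars []       = []
encodeVars (x ∷ xs) = replicate (toℕ x) stroke ++ stop ∷ encodeVars xs

-- Polish notation, hence uniquely readable without brackets.
encode : ∀ {S n} → Formula S n → List (Symbol S)
encode (atom R xs) = relation R ∷ encodeVars xs
encode (φ ∧ ψ)     = and ∷ encode φ ++ encode ψ
encode (φ ∨ ψ)     = or ∷ encode φ ++ encode ψ
encode (quant Q φ) = quantifier Q ∷ encode φ

MC : ∀ {S ℓ} → Structure S ℓ → Pred (List (Symbol S)) ℓ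
MC {S} B w = Σ[ θ ∈ Sentence S ] (w ≡ encode θ) × (B ⊨ θ)

{-# OPTIONS --safe #-}
-- If no sentence breaks ∧ or ∨, then the truth of Q₁v₁ … Qₖvₖ (φ₁ ∧ φ₂) is the
-- conjunction of the truth values of Q₁v₁ … Qₖvₖ φ₁ and Q₁v₁ … Qₖvₖ φ₂, and
-- likewise for ∨. Hence a sentence is a Boolean combination of its atoms, each
-- closed by the quantifiers above it. Quantifiers that bind no argument of the
-- atom may be dropped, because the domain is nonempty, so there are finitely
-- many closed atoms and their truth values can be kept in a finite table.
--
-- The Boolean combination is evaluated from left to right without a stack: the
-- context of an atom is recovered by scanning the input to the left of it. This
-- takes a fixed number of counters bounded by the length of the input, and each
-- of them fits on a work tape of logarithmic length.
module Submission where

open import Defs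
open import Axiom.ExcludedMiddle using (ExcludedMiddle)
open import Data.Product.Base using (∃)
open import Relation.Nullary.Negation using (¬_)
open import Data.Bool.Base as Bool using (Bool; true; false; if_then_else_; not)
open import Data.Empty using (⊥-elim)
open import Data.Fin.Base using (Fin; zero; suc; toℕ; fromℕ<)
open import Data.Fin.Patterns using (0F; 1F)
open import Data.Fin.Properties using (+↔⊎; *↔×; 2↔Bool; _≟_; toℕ<n; toℕ-fromℕ<)
open import Data.List.Base as List using (List; []; _∷_; _++_; _ʳ++_; length; replicate)
import Data.List.Properties as List
open import Data.Maybe.Base using (Maybe; just; nothing)
open import Data.Nat.Base
  using (ℕ; zero; suc; pred; _+_; _*_; _∸_; _^_; _≤_; _<_; z≤n; s≤s; _⊔_)
open import Data.Nat.Logarithm using (⌈log₂_⌉; ⌈log₂⌉-mono-≤; ⌈log₂2*n⌉≡1+⌈log₂n⌉; ⌈log₂2^n⌉≡n)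
import Data.Nat.Properties as ℕ
open import Data.Product.Base using (Σ-syntax; ∃-syntax; _×_; _,_; proj₁; proj₂)
open import Data.Product.Function.NonDependent.Propositional using (_×-↔_)
open import Data.Sum.Base using (_⊎_; inj₁; inj₂)
open import Data.Sum.Function.Propositional using (_⊎-↔_)
open import Data.Unit.Base using (⊤; tt)
import Data.Vec.Base as Vec
open Vec using (Vec; []; _∷_)
import Data.Vec.Properties as Vec
open import Data.Vec.Relation.Unary.All as All using (All; []; _∷_)
open import Function.Base using (_∘_)
open import Function.Bundles using (_↔_; mk↔ₛ′; _⇔_; mk⇔; Equivalence)
open import Function.Properties.Equivalence using ()
  renaming (refl to ⇔-refl; sym to ⇔-sym; trans to ⇔-trans)
open import Function.Properties.Inverse using (↔-refl; ↔-sym; ↔-trans)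
open import Relation.Binary.Construct.Closure.ReflexiveTransitive using (Star; ε; _◅_)
import Relation.Binary.PropositionalEquality as ≡
open ≡ using (_≡_; _≢_; refl; cong; cong₂; subst)
open import Relation.Nullary.Decidable using (Dec; yes; no; does; proof)
open import Relation.Nullary.Negation using (contradiction)
open import Relation.Nullary.Reflects using (Reflects; ofʸ; ofⁿ; invert)
open import Relation.Unary using (Pred)

-- Finite types

-- The obstacle is the stack of connectives whose left operand is being read: its depth can be
-- linear in the input. What makes it dispensable is how a finished left value acts. If the value is
-- neutral for its connective, the compound has the value of the right operand and the connective
-- can be forgotten. If the value decides its connective, it also decides the next pending one of
-- the same kind, and so on up to the first of the other kind, for which it is neutral. So the only
-- thing to remember is how many right operands to skip, which is the length of a run of equal
-- connectives.
--
-- The language contains encodings only, so the same pass must also reject ill-formed words; this is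
-- why skipped operands are still read and their variables still checked for scope.
--
-- The table of closed atoms is not computed from anything: excluded middle provides it for the
-- fixed structure, and only the existence of a machine is claimed.

finite-↔ : ∀ {A B} → A ↔ B → Finite B → Finite A
finite-↔ f (n , g) = n , ↔-trans f g

finite-Fin : ∀ n → Finite (Fin n)
finite-Fin n = n , ↔-refl

finite-Bool : Finite Bool
finite-Bool = 2 , ↔-sym 2↔Bool

finite-⊤ : Finite ⊤
finite-⊤ = 1 , mk↔ₛ′ (λ _ → zero) (λ _ → tt) (λ { zero → refl }) (λ _ → refl)

finite-⊎ : ∀ {A B} → Finite A → Finite B → Finite (A ⊎ B)
finite-⊎ (m , f) (n , g) = m + n , ↔-trans (f ⊎-↔ g) (↔-sym +↔⊎)

finite-× : ∀ {A B} → Finite A → Finite B → Finite (A × B)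
finite-× (m , f) (n , g) = m * n , ↔-trans (f ×-↔ g) (↔-sym *↔×)

finite-Maybe : ∀ {A} → Finite A → Finite (Maybe A)
finite-Maybe {A} A-fin = finite-↔ Maybe↔⊤⊎ (finite-⊎ finite-⊤ A-fin)
  where
  Maybe↔⊤⊎ : Maybe A ↔ (⊤ ⊎ A)
  Maybe↔⊤⊎ = mk↔ₛ′ (λ { nothing → inj₁ tt ; (just x) → inj₂ x })
                   (λ { (inj₁ tt) → nothing ; (inj₂ x) → just x })
                   (λ { (inj₁ tt) → refl ; (inj₂ x) → refl })
                   (λ { nothing → refl ; (just x) → refl })

finite-Vec : ∀ {A} → Finite A → ∀ n → Finite (Vec A n)
finite-Vec A-fin zero    = finite-↔ (mk↔ₛ′ (λ _ → tt) (λ _ → []) (λ _ → refl) (λ { [] → refl })) finite-⊤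
finite-Vec A-fin (suc n) =
  finite-↔ (mk↔ₛ′ (λ { (x ∷ xs) → x , xs }) (λ { (x , xs) → x ∷ xs })
                  (λ { (x , xs) → refl }) (λ { (x ∷ xs) → refl }))
           (finite-× A-fin (finite-Vec A-fin n))

-- Counter machines and their simulation on logarithmic space

data Op : Set where
  hold inc dec : Op

applyOp : Op → ℕ → ℕ
applyOp hold n = n
applyOp inc  n = suc n
applyOp dec  n = pred n

isZero : ℕ → Bool
isZero zero    = true
isZero (suc _) = false

record CounterMachine (A : Set) : Set₁ where
  field
    State       : Set
    #counters   : ℕ
    inputFinite : Finite A
    stateFinite : Finite State
    start       : State
    -- The vector of Booleans tells which counters are zero.
    δ : State → InputCell A → Vec Bool #counters → Bool ⊎ (State × Move × Vec Op #counters)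

module CounterRun {A : Set} (M : CounterMachine A) where
  open CounterMachine M

  record Config : Set where
    constructor config
    field
      state    : State
      inputPos : ℕ
      counters : Vec ℕ #counters

  initial : Config
  initial = config start 0 (Vec.replicate #counters 0)

  apply : List A → Config → Bool ⊎ (State × Move × Vec Op #counters) → Bool ⊎ Config
  apply w c              (inj₁ b)              = inj₁ b
  apply w (config q p ns) (inj₂ (q′ , m , ops)) =
    inj₂ (config q′ (moveInput w m p) (Vec.zipWith applyOp ops ns))

  step : List A → Config → Bool ⊎ Config
  step w c@(config q p ns) = apply w c (δ q (readInput w p) (Vec.map isZero ns))

  data Halts (w : List A) (N : ℕ) (c : Config) (b : Bool) : Set where
    halt : All (_≤ N) (Config.counters c) → step w c ≡ inj₁ b → Halts w N c b
    next : ∀ {d} → All (_≤ N) (Config.counters c) → step w c ≡ inj₂ d → Halts w N d b →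
           Halts w N c b

-- Counters are kept in bijective base 2 with the least significant digit
-- first: zero is the empty numeral, so it is recognised by one cell.
digits⁺ : List (Fin 2) → List (Fin 2)
digits⁺ []        = 0F ∷ []
digits⁺ (0F ∷ ds) = 1F ∷ ds
digits⁺ (1F ∷ ds) = 0F ∷ digits⁺ ds

digits : ℕ → List (Fin 2)
digits zero    = []
digits (suc n) = digits⁺ (digits n)

digits⁻ : List (Fin 2) → List (Fin 2)
digits⁻ []             = []
digits⁻ (1F ∷ ds)      = 0F ∷ ds
digits⁻ (0F ∷ [])      = []
digits⁻ (0F ∷ d ∷ ds)  = 1F ∷ digits⁻ (d ∷ ds)

digits⁻-digits⁺ : ∀ ds → digits⁻ (digits⁺ ds) ≡ ds
digits⁻-digits⁺ []                  = refl
digits⁻-digits⁺ (0F ∷ ds)           = refl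
digits⁻-digits⁺ (1F ∷ [])           = refl
digits⁻-digits⁺ (1F ∷ 0F ∷ ds)      = refl
digits⁻-digits⁺ (1F ∷ 1F ∷ ds)      = cong (1F ∷_) (digits⁻-digits⁺ (1F ∷ ds))

value : List (Fin 2) → ℕ
value []       = 0
value (d ∷ ds) = suc (toℕ d) + 2 * value ds

value-digits⁺ : ∀ ds → value (digits⁺ ds) ≡ suc (value ds)
value-digits⁺ []        = refl
value-digits⁺ (0F ∷ ds) = refl
value-digits⁺ (1F ∷ ds) rewrite value-digits⁺ ds = cong suc (ℕ.*-suc 2 (value ds))

value-digits : ∀ n → value (digits n) ≡ n
value-digits zero    = refl
value-digits (suc n) = ≡.trans (value-digits⁺ (digits n)) (cong suc (value-digits n))

2^length≤1+value : ∀ ds → 2 ^ length ds ≤ suc (value ds)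
2^length≤1+value []       = s≤s z≤n
2^length≤1+value (d ∷ ds) = begin
  2 * 2 ^ length ds              ≤⟨ ℕ.*-monoʳ-≤ 2 (2^length≤1+value ds) ⟩
  2 * suc (value ds)             ≡⟨ ℕ.*-suc 2 (value ds) ⟩
  suc (suc (2 * value ds))       ≤⟨ s≤s (s≤s (ℕ.m≤n+m _ (toℕ d))) ⟩
  suc (suc (toℕ d) + 2 * value ds) ∎
  where open ℕ.≤-Reasoning

length-digits : ∀ n → length (digits n) ≤ ⌈log₂ suc n ⌉
length-digits n = begin
  length (digits n)                ≡⟨ ⌈log₂2^n⌉≡n (length (digits n)) ⟨
  ⌈log₂ 2 ^ length (digits n) ⌉    ≤⟨ ⌈log₂⌉-mono-≤ (2^length≤1+value (digits n)) ⟩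
  ⌈log₂ suc (value (digits n)) ⌉   ≡⟨ cong (λ k → ⌈log₂ suc k ⌉) (value-digits n) ⟩
  ⌈log₂ suc n ⌉                    ∎
  where open ℕ.≤-Reasoning

⌈log₂1+n⌉≤1+⌈log₂n⌉ : ∀ n → ⌈log₂ suc n ⌉ ≤ suc ⌈log₂ n ⌉
⌈log₂1+n⌉≤1+⌈log₂n⌉ zero      = z≤n
⌈log₂1+n⌉≤1+⌈log₂n⌉ n@(suc k) = begin
  ⌈log₂ suc n ⌉   ≤⟨ ⌈log₂⌉-mono-≤ (s≤s (ℕ.m≤n+m n k)) ⟩
  ⌈log₂ n + n ⌉   ≡⟨ cong (λ m → ⌈log₂ n + m ⌉) (ℕ.+-identityʳ n) ⟨
  ⌈log₂ 2 * n ⌉   ≡⟨ ⌈log₂2*n⌉≡1+⌈log₂n⌉ n ⟩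
  suc ⌈log₂ n ⌉   ∎
  where open ℕ.≤-Reasoning

-- Updating one counter on one work tape

Cell : Set
Cell = Fin 3

pattern empty = zero
pattern digit d = suc d

-- `erase` removes a leading digit that was used up; `rewind` returns to the
-- least significant digit, just after the first empty cell on the left.
pattern idle   = zero
pattern carry  = suc zero
pattern borrow = suc (suc zero)
pattern erase  = suc (suc (suc zero))
pattern rewind = suc (suc (suc (suc zero)))

Phase : Set
Phase = Fin 5

-- The cell `digit 0F` is the digit one and `digit 1F` the digit two. A borrow rewrites a one as a
-- two before it knows whether a higher digit can pay for it. Meeting `empty` next shows that the
-- rewritten digit was the leading one and has to vanish instead, which is the task of `erase`.
phaseStep : Phase → Cell → Phase × Cell × Move
phaseStep idle   x          = idle   , x        , stay
phaseStep carry  (digit 1F) = carry  , digit 0F , right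
phaseStep carry  (digit 0F) = rewind , digit 1F , left
phaseStep carry  empty      = rewind , digit 0F , left
phaseStep borrow (digit 1F) = rewind , digit 0F , left
phaseStep borrow (digit 0F) = borrow , digit 1F , right
phaseStep borrow empty      = erase  , empty    , left
phaseStep erase  x          = rewind , empty    , left
phaseStep rewind (digit d)  = rewind , digit d  , left
phaseStep rewind empty      = idle   , empty    , right

nextPhase : Phase → Cell → Phase
nextPhase p x = proj₁ (phaseStep p x)

action : Phase → Cell → Cell × Move
action p x = proj₂ (phaseStep p x)

tapeStep : Phase → Tape Cell → Tape Cell
tapeStep p t = writeMove empty (action p (Tape.head t)) t

launch : Op → Cell → Phase
launch hold _         = idle
launch inc  _         = carry
launch dec  empty     = idle
launch dec  (digit _) = borrow

isEmpty : Cell → Bool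
isEmpty empty     = true
isEmpty (digit _) = false

-- Only visited cells are represented, so a numeral may end exactly at the border of the tape
-- (`single`) or be followed by visited blanks (`empties`) left over from a longer numeral.
data Cells : List (Fin 2) → Cell → List Cell → Set where
  empties : ∀ j → Cells [] empty (replicate j empty)
  single  : ∀ d → Cells (d ∷ []) (digit d) []
  _∷_     : ∀ d {ds x xs} → Cells ds x xs → Cells (d ∷ ds) (digit d) (x ∷ xs)

oneDigit : ∀ d j → Cells (d ∷ []) (digit d) (replicate j empty)
oneDigit d zero    = single d
oneDigit d (suc j) = d ∷ empties j

replaceDigit : ∀ {d ds x xs} d′ → Cells (d ∷ ds) x xs → Cells (d′ ∷ ds) (digit d′) xs
replaceDigit d′ (single _) = single d′
replaceDigit d′ (_ ∷ c)    = d′ ∷ c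

headIsEmpty : ∀ {ds x xs} → Cells ds x xs → isEmpty x ≡ isZero (length ds)
headIsEmpty (empties _) = refl
headIsEmpty (single _)  = refl
headIsEmpty (_ ∷ _)     = refl

length-digits⁺ : ∀ ds → isZero (length (digits⁺ ds)) ≡ false
length-digits⁺ []        = refl
length-digits⁺ (0F ∷ _)  = refl
length-digits⁺ (1F ∷ _)  = refl

isZero-length-digits : ∀ n → isZero (length (digits n)) ≡ isZero n
isZero-length-digits zero    = refl
isZero-length-digits (suc n) = length-digits⁺ (digits n)

module CounterTape (L : ℕ) where

  -- The two shapes of `ls` are a tape that has never been rewound and one on which rewinding has
  -- already visited the blank left of the numeral. That blank is the one cell beyond `L` in
  -- `visited≤`.
  data Stores : Tape Cell → ℕ → Set where
    stores : ∀ {ls x rs n} → ls ≡ [] ⊎ ls ≡ empty ∷ [] → Cells (digits n) x rs →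
             suc (length rs) ≤ L → Stores (tape ls x rs) n

  visited≤ : ∀ {t n} → Stores t n → visited t ≤ suc L
  visited≤ (stores (inj₁ refl) _ r≤) = ℕ.m≤n⇒m≤1+n r≤
  visited≤ (stores (inj₂ refl) _ r≤) = s≤s r≤

  -- The bound T on the number of steps serves only to run several tapes in
  -- parallel until the last one is idle.
  data Settles : ℕ → Phase → Tape Cell → ℕ → Set where
    settled : ∀ {T t n} → Stores t n → Settles T idle t n
    busy    : ∀ {T p t n} → visited t ≤ suc L →
              Settles T (nextPhase p (Tape.head t)) (tapeStep p t) n → Settles (suc T) p t n

  Eventually : Phase → Tape Cell → ℕ → Set
  Eventually p t n = ∃[ T ] Settles T p t n

  after : ∀ {p t n} → visited t ≤ suc L →
          Eventually (nextPhase p (Tape.head t)) (tapeStep p t) n → Eventually p t n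
  after v≤ (T , s) = suc T , busy v≤ s

  settles-mono : ∀ {T T′ p t n} → T ≤ T′ → Settles T p t n → Settles T′ p t n
  settles-mono _         (settled s) = settled s
  settles-mono (s≤s T≤) (busy v≤ s) = busy v≤ (settles-mono T≤ s)

  settles-step : ∀ {T p t n} → Settles (suc T) p t n →
                 Settles T (nextPhase p (Tape.head t)) (tapeStep p t) n
  settles-step (settled s) = settled s
  settles-step (busy _ s)  = s

  settles-visited : ∀ {T p t n} → Settles T p t n → visited t ≤ suc L
  settles-visited (settled s) = visited≤ s
  settles-visited (busy v≤ _) = v≤

  settles-idle : ∀ {T t n} → Settles T idle t n → Stores t n
  settles-idle (settled s) = s
  settles-idle (busy _ s)  = settles-idle s

  settles-zero : ∀ {p t n} → Settles 0 p t n → p ≡ idle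
  settles-zero (settled _) = refl

  -- A continuation for the way back: once the digits from the current cell on are `ds`, rewinding
  -- completes the update to `n`. Carry and borrow recurse to the right and extend it by each digit
  -- that they leave behind.
  RewindsTo : ℕ → List Cell → List (Fin 2) → ℕ → Set
  RewindsTo K ls ds n = ∀ {x rs} → Cells ds x rs → length ls + suc (length rs) ≤ K →
    Eventually rewind (moveTape empty left (tape ls x rs)) n

  -- `K` bounds the whole tape: it is `L` when nothing lies left of the numeral and `suc L` when the
  -- blank does. Keeping it exact lets the part from the numeral on be bounded by `L` again after
  -- the update.
  module _ {K n : ℕ} (K≤ : K ≤ suc L) where

    rewind-one : ∀ {ls ds} d → RewindsTo K ls (d ∷ ds) n → RewindsTo K (digit d ∷ ls) ds n
    rewind-one {ls} d k {x} {rs} c v≤ = after {rewind} (ℕ.≤-trans v≤′ K≤) (k (d ∷ c) v≤′)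
      where
      v≤′ : length ls + suc (suc (length rs)) ≤ K
      v≤′ = subst (_≤ K) (≡.sym (ℕ.+-suc (length ls) _)) v≤

    carry-settles : ∀ {ls ds x rs} → Cells ds x rs → length ls + suc (length rs) ≤ K →
      length ls + suc (suc (length ds)) ≤ K → RewindsTo K ls (digits⁺ ds) n →
      Eventually carry (tape ls x rs) n
    carry-settles (empties j) v≤ d≤ k = after {carry} (ℕ.≤-trans v≤ K≤) (k (oneDigit 0F j) v≤)
    carry-settles c@(single 0F) v≤ d≤ k =
      after {carry} (ℕ.≤-trans v≤ K≤) (k (replaceDigit 1F c) v≤)
    carry-settles {ls} (single 1F) v≤ d≤ k = after {carry} (ℕ.≤-trans v≤ K≤)
      (carry-settles (empties 0)
        (ℕ.≤-trans (ℕ.≤-reflexive (≡.sym (ℕ.+-suc (length ls) 1)))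
          (ℕ.≤-trans (ℕ.+-monoʳ-≤ (length ls) (s≤s (s≤s z≤n))) d≤))
        (subst (_≤ K) (ℕ.+-suc (length ls) _) d≤)
        (rewind-one 0F k))
    carry-settles c@(0F ∷ _) v≤ d≤ k =
      after {carry} (ℕ.≤-trans v≤ K≤) (k (replaceDigit 1F c) v≤)
    carry-settles {ls} (1F ∷ c) v≤ d≤ k = after {carry} (ℕ.≤-trans v≤ K≤)
      (carry-settles c (subst (_≤ K) (ℕ.+-suc (length ls) _) v≤)
                       (subst (_≤ K) (ℕ.+-suc (length ls) _) d≤) (rewind-one 0F k))

    borrow-settles : ∀ {ls d ds x rs} → Cells (d ∷ ds) x rs → length ls + suc (length rs) ≤ K →
      length ls + suc (suc (length ds)) ≤ K → RewindsTo K ls (digits⁻ (d ∷ ds)) n →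
      Eventually borrow (tape ls x rs) n
    borrow-settles c@(single 1F) v≤ d≤ k =
      after {borrow} (ℕ.≤-trans v≤ K≤) (k (replaceDigit 0F c) v≤)
    borrow-settles {ls} (single 0F) v≤ d≤ k = after {borrow} (ℕ.≤-trans v≤ K≤)
      (after {borrow} (ℕ.≤-trans (subst (_≤ K) (ℕ.+-suc (length ls) 1) d≤) K≤)
        (after {erase} (ℕ.≤-trans d≤ K≤) (k (empties 1) d≤)))
    borrow-settles c@(1F ∷ _) v≤ d≤ k =
      after {borrow} (ℕ.≤-trans v≤ K≤) (k (replaceDigit 0F c) v≤)
    borrow-settles {ls} (0F ∷ empties j) v≤ d≤ k = after {borrow} (ℕ.≤-trans v≤ K≤)
      (after {borrow} (ℕ.≤-trans (subst (_≤ K) (ℕ.+-suc (length ls) _) v≤) K≤)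
        (after {erase} (ℕ.≤-trans v≤ K≤) (k (empties (suc j)) v≤)))
    borrow-settles {ls} (0F ∷ c@(single _)) v≤ d≤ k = after {borrow} (ℕ.≤-trans v≤ K≤)
      (borrow-settles c (subst (_≤ K) (ℕ.+-suc (length ls) _) v≤)
                        (subst (_≤ K) (ℕ.+-suc (length ls) _) d≤) (rewind-one 1F k))
    borrow-settles {ls} (0F ∷ c@(_ ∷ _)) v≤ d≤ k = after {borrow} (ℕ.≤-trans v≤ K≤)
      (borrow-settles c (subst (_≤ K) (ℕ.+-suc (length ls) _) v≤)
                        (subst (_≤ K) (ℕ.+-suc (length ls) _) d≤) (rewind-one 1F k))

  rewind-settles : ∀ {ls n x rs} → ls ≡ [] ⊎ ls ≡ empty ∷ [] → Cells (digits n) x rs →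
    suc (length rs) ≤ L → Eventually rewind (moveTape empty left (tape ls x rs)) n
  rewind-settles {x = x} {rs} (inj₁ refl) c r≤ =
    after {rewind} {tape [] empty (x ∷ rs)} (s≤s r≤) (0 , settled (stores (inj₂ refl) c r≤))
  rewind-settles {x = x} {rs} (inj₂ refl) c r≤ =
    after {rewind} {tape [] empty (x ∷ rs)} (s≤s r≤) (0 , settled (stores (inj₂ refl) c r≤))

  carry-from : ∀ {t n} → Stores t n → suc (suc (length (digits n))) ≤ L → Eventually carry t (suc n)
  carry-from (stores e@(inj₁ refl) c r≤) d≤ =
    carry-settles (ℕ.n≤1+n L) c r≤ d≤ (rewind-settles e)
  carry-from (stores e@(inj₂ refl) c r≤) d≤ =
    carry-settles ℕ.≤-refl c (s≤s r≤) (s≤s d≤) λ c′ r≤′ → rewind-settles e c′ (ℕ.≤-pred r≤′)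

  -- `digits (suc n)` does not reduce to a cons, so the list is generalised to `ds`, and equations
  -- record that it is nonempty and what its predecessor is.
  borrow-nonempty : ∀ {ls ds n x rs} → ls ≡ [] ⊎ ls ≡ empty ∷ [] → Cells ds x rs →
    suc (length rs) ≤ L → isZero (length ds) ≡ false → digits⁻ ds ≡ digits n →
    suc (length ds) ≤ L → Eventually borrow (tape ls x rs) n
  borrow-nonempty {ds = _ ∷ _} {n} e@(inj₁ refl) c r≤ _ eq d≤ =
    borrow-settles (ℕ.n≤1+n L) c r≤ d≤
      λ c′ r≤′ → rewind-settles e (subst (λ ds → Cells ds _ _) eq c′) r≤′
  borrow-nonempty {ds = _ ∷ _} {n} e@(inj₂ refl) c r≤ _ eq d≤ =
    borrow-settles ℕ.≤-refl c (s≤s r≤) (s≤s d≤)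
      λ c′ r≤′ → rewind-settles e (subst (λ ds → Cells ds _ _) eq c′) (ℕ.≤-pred r≤′)

  launch-settles : ∀ op {t n} → Stores t n → suc (suc (length (digits n))) ≤ L →
                   Eventually (launch op (Tape.head t)) t (applyOp op n)
  launch-settles hold s d≤ = 0 , settled s
  launch-settles inc  s d≤ = carry-from s d≤
  launch-settles dec {n = zero} s@(stores _ (empties _) _) d≤ = 0 , settled s
  launch-settles dec {n = suc n} (stores {x = x} e c r≤) d≤
    with x | c | headIsEmpty c
  ... | empty   | _  | eq = contradiction (≡.trans eq (length-digits⁺ (digits n))) λ ()
  ... | digit _ | c′ | _  = borrow-nonempty e c′ r≤ (length-digits⁺ (digits n))
                              (digits⁻-digits⁺ (digits n)) (ℕ.≤-trans (ℕ.n≤1+n _) d≤)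

  stores-isEmpty : ∀ {t n} → Stores t n → isEmpty (Tape.head t) ≡ isZero n
  stores-isEmpty {n = n} (stores _ c _) = ≡.trans (headIsEmpty c) (isZero-length-digits n)

-- All counters at once: Turing machine simulation of a counter machine

module Simulation {A : Set} (M : CounterMachine A) where
  open CounterMachine M
  private
    module C = CounterRun M

  Command : Set
  Command = Bool ⊎ ((State × Vec Phase #counters) × Move × Vec (Cell × Move) #counters)

  AllIdle : ∀ {k} → Vec Phase k → Set
  AllIdle = All (_≡ idle)

  allIdle? : ∀ {k} (ps : Vec Phase k) → Dec (AllIdle ps)
  allIdle? = All.all? (_≟ idle)

  -- This step already changes the state and moves the input head, but writes every work cell back
  -- unchanged. The tapes catch up in later steps, during which the input head stays put; the zero
  -- tests of the next instruction are read when all tapes are idle again.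
  begin-update : Vec Cell #counters → Bool ⊎ (State × Move × Vec Op #counters) → Command
  begin-update xs (inj₁ b)             = inj₁ b
  begin-update xs (inj₂ (q , m , ops)) =
    inj₂ ((q , Vec.zipWith launch ops xs) , m , Vec.map (_, stay) xs)

  δᵀ : State × Vec Phase #counters → InputCell A → Vec Cell #counters → Command
  δᵀ (q , ps) c xs with allIdle? ps
  ... | yes _ = begin-update xs (δ q c (Vec.map isEmpty xs))
  ... | no  _ = inj₂ ((q , Vec.zipWith nextPhase ps xs) , stay , Vec.zipWith action ps xs)

  machine : TM A
  machine = record
    { State       = State × Vec Phase #counters
    ; Work        = Cell
    ; #tapes      = #counters
    ; inputFinite = inputFinite
    ; stateFinite = finite-× stateFinite (finite-Vec (finite-Fin 5) #counters)
    ; workFinite  = finite-Fin 3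
    ; start       = start , Vec.replicate #counters idle
    ; blank       = empty
    ; δ           = δᵀ
    }

  open Run machine

  step-δ : ∀ {w q p ts q′ m as} → δᵀ q (readInput w p) (Vec.map Tape.head ts) ≡ inj₂ (q′ , m , as) →
           step w (config q p ts) ≡
           inj₂ (config q′ (moveInput w m p) (Vec.zipWith (writeMove empty) as ts))
  step-δ eq rewrite eq = refl

  step-δ-halt : ∀ {w q p ts b} → δᵀ q (readInput w p) (Vec.map Tape.head ts) ≡ inj₁ b →
                step w (config q p ts) ≡ inj₁ b
  step-δ-halt eq rewrite eq = refl

  δᵀ-idle : ∀ {q ps c xs} → AllIdle ps →
            δᵀ (q , ps) c xs ≡ begin-update xs (δ q c (Vec.map isEmpty xs))
  δᵀ-idle {ps = ps} ps-idle with allIdle? ps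
  ... | yes _    = refl
  ... | no ¬idle = contradiction ps-idle ¬idle

  δᵀ-busy : ∀ {q ps c xs} → ¬ AllIdle ps → δᵀ (q , ps) c xs ≡
            inj₂ ((q , Vec.zipWith nextPhase ps xs) , stay , Vec.zipWith action ps xs)
  δᵀ-busy {ps = ps} ¬idle with allIdle? ps
  ... | yes ps-idle = contradiction ps-idle ¬idle
  ... | no _        = refl

  data HaltsWithin (w : List A) (s : ℕ) (c : Config) (b : Bool) : Set where
    halt : space c ≤ s → step w c ≡ inj₁ b → HaltsWithin w s c b
    next : ∀ {d} → space c ≤ s → step w c ≡ inj₂ d → HaltsWithin w s d b → HaltsWithin w s c b

  haltsWithin-output : ∀ {w s c b} → HaltsWithin w s c b →
    ∃[ d ] Star (λ c d → step w c ≡ inj₂ d) c d × step w d ≡ inj₁ b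
  haltsWithin-output (halt _ eq) = _ , ε , eq
  haltsWithin-output (next _ eq h) with haltsWithin-output h
  ... | d , path , out = d , eq ◅ path , out

  -- Since `step` is a function, every path from `c` is an initial segment of the halting run, whose
  -- configurations all carry the bound.
  haltsWithin-space : ∀ {w s c b d} → HaltsWithin w s c b →
    Star (λ c d → step w c ≡ inj₂ d) c d → space d ≤ s
  haltsWithin-space (halt s≤ _)    ε = s≤
  haltsWithin-space (next s≤ _ _)  ε = s≤
  haltsWithin-space (halt _ eq)   (eq′ ◅ _) = contradiction (≡.trans (≡.sym eq) eq′) λ ()
  haltsWithin-space (next _ eq h) (eq′ ◅ path) with ≡.trans (≡.sym eq) eq′
  ... | refl = haltsWithin-space h path

  module _ (L : ℕ) where
    open CounterTape L

    data Tapes (P : Tape Cell → ℕ → Set) : ∀ {k} → Vec (Tape Cell) k → Vec ℕ k → Set where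
      []  : Tapes P [] []
      _∷_ : ∀ {k t n} {ts : Vec _ k} {ns} → P t n → Tapes P ts ns → Tapes P (t ∷ ts) (n ∷ ns)

    data AllSettle (T : ℕ) : ∀ {k} → Vec Phase k → Vec (Tape Cell) k → Vec ℕ k → Set where
      []  : AllSettle T [] [] []
      _∷_ : ∀ {k p t n ps} {ts : Vec _ k} {ns} → Settles T p t n → AllSettle T ps ts ns →
            AllSettle T (p ∷ ps) (t ∷ ts) (n ∷ ns)

    allSettle-mono : ∀ {T T′ k ps} {ts : Vec _ k} {ns} → T ≤ T′ →
                     AllSettle T ps ts ns → AllSettle T′ ps ts ns
    allSettle-mono T≤ []       = []
    allSettle-mono T≤ (s ∷ ss) = settles-mono T≤ s ∷ allSettle-mono T≤ ss

    allSettle-step : ∀ {T k ps} {ts : Vec _ k} {ns} → AllSettle (suc T) ps ts ns →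
      AllSettle T (Vec.zipWith nextPhase ps (Vec.map Tape.head ts))
        (Vec.zipWith (writeMove empty) (Vec.zipWith action ps (Vec.map Tape.head ts)) ts) ns
    allSettle-step []       = []
    allSettle-step (s ∷ ss) = settles-step s ∷ allSettle-step ss

    allSettle-space : ∀ {T k ps} {ts : Vec _ k} {ns} → AllSettle T ps ts ns →
                      Vec.sum (Vec.map visited ts) ≤ k * suc L
    allSettle-space []       = z≤n
    allSettle-space (s ∷ ss) = ℕ.+-mono-≤ (settles-visited s) (allSettle-space ss)

    allSettle-zero : ∀ {k ps} {ts : Vec _ k} {ns} → AllSettle 0 ps ts ns → AllIdle ps
    allSettle-zero []       = []
    allSettle-zero (s ∷ ss) = settles-zero s ∷ allSettle-zero ss

    allSettle-idle : ∀ {T k ps} {ts : Vec _ k} {ns} → AllIdle ps →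
                     AllSettle T ps ts ns → Tapes Stores ts ns
    allSettle-idle []            []       = []
    allSettle-idle (refl ∷ is) (s ∷ ss) = settles-idle s ∷ allSettle-idle is ss

    tapes-space : ∀ {k} {ts : Vec _ k} {ns} → Tapes Stores ts ns →
                  Vec.sum (Vec.map visited ts) ≤ k * suc L
    tapes-space []       = z≤n
    tapes-space (s ∷ ss) = ℕ.+-mono-≤ (visited≤ s) (tapes-space ss)

    tapes-isEmpty : ∀ {k} {ts : Vec _ k} {ns} → Tapes Stores ts ns →
                    Vec.map isEmpty (Vec.map Tape.head ts) ≡ Vec.map isZero ns
    tapes-isEmpty []       = refl
    tapes-isEmpty (s ∷ ss) = cong₂ _∷_ (stores-isEmpty s) (tapes-isEmpty ss)

    tapes-launch : ∀ {k} (ops : Vec Op k) {ts ns} → Tapes Stores ts ns →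
      All (λ n → suc (suc (length (digits n))) ≤ L) ns →
      ∃[ T ] AllSettle T (Vec.zipWith launch ops (Vec.map Tape.head ts))
               (Vec.zipWith (writeMove empty) (Vec.map (_, stay) (Vec.map Tape.head ts)) ts)
               (Vec.zipWith applyOp ops ns)
    tapes-launch []         []       []         = 0 , []
    tapes-launch (op ∷ ops) (s ∷ ss) (d≤ ∷ ds≤) with launch-settles op s d≤ | tapes-launch ops ss ds≤
    ... | T , s′ | U , ss′ =
      T ⊔ U , settles-mono (ℕ.m≤m⊔n T U) s′ ∷ allSettle-mono (ℕ.m≤n⊔m T U) ss′

    settle-halts : ∀ {w q pos b} T {ps ts ns} → AllSettle T ps ts ns →
      (∀ {ps ts} → AllIdle ps → Tapes Stores ts ns →
        HaltsWithin w (#counters * suc L) (config (q , ps) pos ts) b) →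
      HaltsWithin w (#counters * suc L) (config (q , ps) pos ts) b
    settle-halts T {ps} ss k with allIdle? ps
    settle-halts T       ss k | yes ps-idle = k ps-idle (allSettle-idle ps-idle ss)
    settle-halts zero    ss k | no ¬idle    = contradiction (allSettle-zero ss) ¬idle
    settle-halts (suc T) {ps} ss k | no ¬idle    =
      next (allSettle-space ss) (step-δ {q = _ , ps} (δᵀ-busy ¬idle)) (settle-halts T (allSettle-step ss) k)

    simulate : ∀ {N w q pos ns b ps ts} → (∀ {n} → n ≤ N → suc (suc (length (digits n))) ≤ L) →
      C.Halts w N (C.config q pos ns) b → AllIdle ps → Tapes Stores ts ns →
      HaltsWithin w (#counters * suc L) (config (q , ps) pos ts) b
    simulate {w = w} {q} {pos} {ns} {ps = ps} {ts} fits (C.halt _ eq) ps-idle ss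
      with δ q (readInput w pos) (Vec.map isZero ns) in δ-eq
    simulate {w = w} {q} {pos} {ns} {ps = ps} {ts} fits (C.halt _ refl) ps-idle ss | inj₁ b =
      halt (tapes-space ss) (step-δ-halt {q = q , ps} (≡.trans (δᵀ-idle ps-idle)
        (cong (begin-update _)
          (≡.trans (cong (δ q (readInput w pos)) (tapes-isEmpty ss)) δ-eq))))
    simulate {w = w} {q} {pos} {ns} {ps = ps} {ts} fits (C.next ns≤ eq h) ps-idle ss
      with δ q (readInput w pos) (Vec.map isZero ns) in δ-eq
    simulate {w = w} {q} {pos} {ns} {ps = ps} {ts} fits (C.next ns≤ refl h) ps-idle ss
      | inj₂ (q′ , m , ops) with tapes-launch ops ss (All.map fits ns≤)
    ... | T , ss′ =
      next (tapes-space ss) (step-δ {q = q , ps} (≡.trans (δᵀ-idle ps-idle)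
        (cong (begin-update _)
          (≡.trans (cong (δ q (readInput w pos)) (tapes-isEmpty ss)) δ-eq))))
        (settle-halts T ss′ λ ps-idle′ ts-store → simulate fits h ps-idle′ ts-store)

    initial-tapes : ∀ k → 1 ≤ L → Tapes Stores (Vec.replicate k (tape [] empty [])) (Vec.replicate k 0)
    initial-tapes zero    1≤L = []
    initial-tapes (suc k) 1≤L = stores (inj₁ refl) (empties 0) 1≤L ∷ initial-tapes k 1≤L

    all-idle : ∀ k → AllIdle (Vec.replicate k idle)
    all-idle zero    = []
    all-idle (suc k) = refl ∷ all-idle k

-- From linearly bounded counters to logarithmic space

inLogspace : ∀ {A ℓ} (M : CounterMachine A) (P : Pred (List A) ℓ) →
  (∀ w → ∃[ b ] CounterRun.Halts M w (suc (length w)) (CounterRun.initial M) b × Reflects (P w) b) →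
  InLogspace P
-- The factor 5 is 3 + 2. Each tape has two cells beyond the numeral, room for the digit that a
-- carry adds or the blank that a borrow probes, and the blank on its left. Two more come from
-- passing from the logarithm of `suc (suc (length w))` to that of `length w`.
inLogspace {A} M P run = machine , decides , 5 * #counters , space≤
  where
  open CounterMachine M using (#counters)
  open Simulation M
  open Run machine

  bound : List A → ℕ
  bound w = suc (suc ⌈log₂ suc (suc (length w)) ⌉)

  fits : ∀ w {n} → n ≤ suc (length w) → suc (suc (length (digits n))) ≤ bound w
  fits w {n} n≤ = s≤s (s≤s (ℕ.≤-trans (length-digits n) (⌈log₂⌉-mono-≤ (s≤s n≤))))

  halts : ∀ w → HaltsWithin w (#counters * suc (bound w)) initial (proj₁ (run w))
  halts w = simulate (bound w) (fits w) (proj₁ (proj₂ (run w))) (all-idle (bound w) #counters)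
              (initial-tapes (bound w) #counters (s≤s z≤n))

  decides : Decides machine P
  decides w = proj₁ (run w) , haltsWithin-output (halts w) , proj₂ (proj₂ (run w))

  space≤ : ∀ w κ → Reachable w κ → space κ ≤ 5 * #counters * suc ⌈log₂ length w ⌉
  space≤ w κ reach = begin
    space κ                        ≤⟨ haltsWithin-space (halts w) reach ⟩
    #counters * suc (bound w)      ≤⟨ ℕ.*-monoʳ-≤ #counters (ℕ.+-monoʳ-≤ 3 log≤) ⟩
    #counters * (5 + l)            ≤⟨ ℕ.*-monoʳ-≤ #counters (ℕ.+-monoʳ-≤ 5 (ℕ.m≤m+n l _)) ⟩
    #counters * (5 + 5 * l)        ≡⟨ cong (#counters *_) (ℕ.*-suc 5 l) ⟨
    #counters * (5 * suc l)        ≡⟨ ℕ.*-assoc #counters 5 (suc l) ⟨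
    #counters * 5 * suc l          ≡⟨ cong (_* suc l) (ℕ.*-comm #counters 5) ⟩
    5 * #counters * suc l          ∎
    where
    open ℕ.≤-Reasoning
    l = ⌈log₂ length w ⌉

    log≤ : ⌈log₂ suc (suc (length w)) ⌉ ≤ 2 + l
    log≤ = ℕ.≤-trans (⌈log₂1+n⌉≤1+⌈log₂n⌉ (suc (length w))) (s≤s (⌈log₂1+n⌉≤1+⌈log₂n⌉ (length w)))

-- Closed atoms

-- Lists of length at most `n`, as nested `Maybe`s so that finiteness follows by recursion and they
-- can be part of a machine state.
Upto : Set → ℕ → Set
Upto X zero    = ⊤
Upto X (suc n) = Maybe (X × Upto X n)

finite-Upto : ∀ {X} → Finite X → ∀ n → Finite (Upto X n)
finite-Upto X-fin zero    = finite-⊤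
finite-Upto X-fin (suc n) = finite-Maybe (finite-× X-fin (finite-Upto X-fin n))

none : ∀ {X} n → Upto X n
none zero    = tt
none (suc n) = nothing

toList : ∀ {X} n → Upto X n → List X
toList zero    _              = []
toList (suc n) nothing        = []
toList (suc n) (just (x , c)) = x ∷ toList n c

truncate : ∀ {X} n → Upto X (suc n) → Upto X n
truncate zero    _              = tt
truncate (suc n) nothing        = nothing
truncate (suc n) (just (x , c)) = just (x , truncate n c)

-- Drops the last entry of a full list.
push : ∀ {X} n → X → Upto X n → Upto X n
push zero    _ _ = tt
push (suc n) x c = just (x , truncate n c)

toList-truncate : ∀ {X} n (c : Upto X (suc n)) → length (toList (suc n) c) ≤ n →
                  toList n (truncate n c) ≡ toList (suc n) c
toList-truncate zero    nothing        _        = refl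
toList-truncate (suc n) nothing        _        = refl
toList-truncate (suc n) (just (x , c)) (s≤s l≤) = cong (x ∷_) (toList-truncate n c l≤)

toList-push : ∀ {X} n x (c : Upto X n) → length (toList n c) < n →
              toList n (push n x c) ≡ x ∷ toList n c
toList-push (suc n) x c (s≤s l≤) = cong (x ∷_) (toList-truncate n c l≤)

-- Argument slots and the quantifiers that bind them

anyTrue : ∀ {n} → Vec Bool n → Bool
anyTrue []       = false
anyTrue (b ∷ bs) = b Bool.∨ anyTrue bs

count : ∀ {n} → Vec Bool n → ℕ
count []           = 0
count (true ∷ bs)  = suc (count bs)
count (false ∷ bs) = count bs

count≤ : ∀ {n} (bs : Vec Bool n) → count bs ≤ n
count≤ []           = z≤n
count≤ (true ∷ bs)  = s≤s (count≤ bs)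
count≤ (false ∷ bs) = ℕ.m≤n⇒m≤1+n (count≤ bs)

hits : ∀ {n} → Vec Bool n → Vec Bool n → Vec Bool n
hits = Vec.zipWith Bool._∧_

misses : ∀ {n} → Vec Bool n → Vec Bool n → Vec Bool n
misses = Vec.zipWith (λ p z → p Bool.∧ not z)

count-misses≤ : ∀ {n} (ps zs : Vec Bool n) → count (misses ps zs) ≤ count ps
count-misses≤ []           []           = z≤n
count-misses≤ (false ∷ ps) (_ ∷ zs)     = count-misses≤ ps zs
count-misses≤ (true ∷ ps)  (true ∷ zs)  = ℕ.m≤n⇒m≤1+n (count-misses≤ ps zs)
count-misses≤ (true ∷ ps)  (false ∷ zs) = s≤s (count-misses≤ ps zs)

-- Every recorded binding uses up at least one unbound slot. This is why a list bounded by the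
-- number of slots never overflows, however many quantifiers there are.
count-misses< : ∀ {n} (ps zs : Vec Bool n) → anyTrue (hits ps zs) ≡ true →
                count (misses ps zs) < count ps
count-misses< []           []           ()
count-misses< (false ∷ ps) (_ ∷ zs)     hit = count-misses< ps zs hit
count-misses< (true ∷ ps)  (true ∷ zs)  hit = s≤s (count-misses≤ ps zs)
count-misses< (true ∷ ps)  (false ∷ zs) hit = s≤s (count-misses< ps zs hit)

assign : ∀ {ℓ} {D : Set ℓ} {n} → Vec Bool n → D → Vec D n → Vec D n
assign zs b = Vec.zipWith (λ z d → if z then b else d) zs

assign-nothing : ∀ {ℓ} {D : Set ℓ} {n} (zs : Vec Bool n) (b : D) g → anyTrue zs ≡ false →
                 assign zs b g ≡ g
assign-nothing []           b []      eq = refl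
assign-nothing (false ∷ zs) b (d ∷ g) eq = cong (d ∷_) (assign-nothing zs b g eq)

nth : ∀ {ℓ} {D : Set ℓ} → List D → ℕ → D → D
nth []      _       d = d
nth (b ∷ _) zero    d = b
nth (_ ∷ ρ) (suc x) d = nth ρ x d

nth-lookup : ∀ {ℓ} {D : Set ℓ} {k} (ρ : Vec D k) y d → nth (Vec.toList ρ) (toℕ y) d ≡ Vec.lookup ρ y
nth-lookup (b ∷ ρ) zero    d = refl
nth-lookup (b ∷ ρ) (suc y) d = nth-lookup ρ y d

fill : ∀ {ℓ} {D : Set ℓ} {n} → Vec Bool n → Vec ℕ n → List D → Vec D n → Vec D n
fill []       []       ρ []      = []
fill (p ∷ ps) (x ∷ xs) ρ (d ∷ g) = (if p then nth ρ x d else d) ∷ fill ps xs ρ g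

fill-[] : ∀ {ℓ} {D : Set ℓ} {n} ps xs (g : Vec D n) → fill ps xs [] g ≡ g
fill-[] []           []       []      = refl
fill-[] (false ∷ ps) (x ∷ xs) (d ∷ g) = cong (d ∷_) (fill-[] ps xs g)
fill-[] (true ∷ ps)  (x ∷ xs) (d ∷ g) = cong (d ∷_) (fill-[] ps xs g)

-- One step of `bindAll` seen on environments: the innermost value goes to the unbound slots with
-- index zero, and the other indices are shifted to the remaining environment.
fill-∷ : ∀ {ℓ} {D : Set ℓ} {n} ps xs b ρ (g : Vec D n) → fill ps xs (b ∷ ρ) g ≡
         assign (hits ps (Vec.map isZero xs)) b
           (fill (misses ps (Vec.map isZero xs)) (Vec.map pred xs) ρ g)
fill-∷ []           []           b ρ []      = refl
fill-∷ (false ∷ ps) (x ∷ xs)     b ρ (d ∷ g) = cong (d ∷_) (fill-∷ ps xs b ρ g)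
fill-∷ (true ∷ ps)  (zero ∷ xs)  b ρ (d ∷ g) = cong (b ∷_) (fill-∷ ps xs b ρ g)
fill-∷ (true ∷ ps)  (suc x ∷ xs) b ρ (d ∷ g) = cong (nth ρ x d ∷_) (fill-∷ ps xs b ρ g)

lookup-fill : ∀ {ℓ} {D : Set ℓ} {n} xs ρ (g : Vec D n) i →
  Vec.lookup (fill (Vec.replicate n true) xs ρ g) i ≡ nth ρ (Vec.lookup xs i) (Vec.lookup g i)
lookup-fill (x ∷ xs) ρ (d ∷ g) zero    = refl
lookup-fill (x ∷ xs) ρ (d ∷ g) (suc i) = lookup-fill xs ρ g i

clamp : ∀ m → ℕ → Fin (suc m)
clamp m       zero    = zero
clamp zero    (suc _) = zero
clamp (suc m) (suc n) = suc (clamp m n)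

toℕ-clamp : ∀ {m n} → n ≤ m → toℕ (clamp m n) ≡ n
toℕ-clamp z≤n      = refl
toℕ-clamp (s≤s n≤) = cong suc (toℕ-clamp n≤)

clamp-≢ : ∀ {m i j} → i < j → j ≤ m → clamp m i ≢ clamp m j
clamp-≢ i<j j≤m eq = ℕ.<⇒≢ i<j (≡.trans (≡.sym (toℕ-clamp (ℕ.≤-trans (ℕ.<⇒≤ i<j) j≤m)))
                                 (≡.trans (cong toℕ eq) (toℕ-clamp j≤m)))

-- The arguments of an atom occupy slots r ∸ 1, …, 0 in reading order.
gather : ∀ {a} {A : Set a} {m} r → Vec A (suc m) → Vec A r
gather     zero    v = []
gather {m = m} (suc r) v = Vec.lookup v (clamp m r) ∷ gather r v

-- Adding to the slot instead of overwriting it lets a partly read argument sit in the slot while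
-- its remaining strokes are still to come, as `store-stroke` requires.
store : ∀ {m r} → Vec ℕ r → Vec ℕ (suc m) → Vec ℕ (suc m)
store             []       xs = xs
store {m} {suc r} (y ∷ ys) xs = store ys (Vec.updateAt xs (clamp m r) (y +_))

lookup-store : ∀ {m r} (ys : Vec ℕ r) (xs : Vec ℕ (suc m)) {j} → r ≤ j → j ≤ m →
               Vec.lookup (store ys xs) (clamp m j) ≡ Vec.lookup xs (clamp m j)
lookup-store             []       xs     r≤j j≤m = refl
lookup-store {m} {suc r} (y ∷ ys) xs {j} r<j j≤m =
  ≡.trans (lookup-store ys _ (ℕ.<⇒≤ r<j) j≤m)
          (Vec.lookup∘updateAt′ (clamp m j) (clamp m r) (λ eq → clamp-≢ r<j j≤m (≡.sym eq)) xs)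

gather-store : ∀ {m r} (ys : Vec ℕ r) (xs : Vec ℕ (suc m)) → r ≤ m →
               (∀ {i} → i < r → Vec.lookup xs (clamp m i) ≡ 0) → gather r (store ys xs) ≡ ys
gather-store             []       xs r≤m zeros = refl
gather-store {m} {suc r} (y ∷ ys) xs r<m zeros = cong₂ _∷_
  (≡.trans (lookup-store ys _ ℕ.≤-refl (ℕ.<⇒≤ r<m))
    (≡.trans (Vec.lookup∘updateAt (clamp m r) xs)
      (≡.trans (cong (y +_) (zeros ℕ.≤-refl)) (ℕ.+-identityʳ y))))
  (gather-store ys _ (ℕ.<⇒≤ r<m) λ i<r →
    ≡.trans (Vec.lookup∘updateAt′ _ (clamp m r) (clamp-≢ i<r (ℕ.<⇒≤ r<m)) xs)
            (zeros (ℕ.m<n⇒m<1+n i<r)))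

gather-zeros-store : ∀ {m r} (ys : Vec ℕ r) → r ≤ m → gather r (store ys (Vec.replicate (suc m) 0)) ≡ ys
gather-zeros-store ys r≤m = gather-store ys _ r≤m λ {i} _ → Vec.lookup-replicate (clamp _ i) 0

-- A variable, represented by its quantifier and the argument slots it occupies.
Binding : ℕ → Set
Binding n = Quantifier × Vec Bool n

-- The bindings found so far, outermost first, and the slots still unbound.
Bindings : ℕ → Set
Bindings n = Upto (Binding n) n × Vec Bool n

unbound : ∀ n → Bindings n
unbound n = none n , Vec.replicate n true

bind : ∀ {n} → Quantifier → Vec Bool n → Bindings n → Bindings n
bind {n} Q zs (c , ps) =
  (if anyTrue (hits ps zs) then push n (Q , hits ps zs) c else c) , misses ps zs

bindAll : ∀ {n} → List Quantifier → Vec ℕ n → Bindings n → Bindings n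
bindAll []       xs s = s
bindAll (Q ∷ qs) xs s = bindAll qs (Vec.map pred xs) (bind Q (Vec.map isZero xs) s)

-- `bindAll` followed on a single slot: whether a slot remains unbound does not depend on the other
-- slots.
stillUnbound : ℕ → Bool → ℕ → Bool
stillUnbound zero    p x = p
stillUnbound (suc n) p x = stillUnbound n (p Bool.∧ not (isZero x)) (pred x)

lookup-bindAll : ∀ {n} qs xs (s : Bindings n) i → Vec.lookup (proj₂ (bindAll qs xs s)) i ≡
                 stillUnbound (length qs) (Vec.lookup (proj₂ s) i) (Vec.lookup xs i)
lookup-bindAll []       xs s        i = refl
lookup-bindAll (Q ∷ qs) xs (c , ps) i
  rewrite lookup-bindAll qs (Vec.map pred xs) (bind Q (Vec.map isZero xs) (c , ps)) i
        | Vec.lookup-zipWith (λ p z → p Bool.∧ not z) i ps (Vec.map isZero xs)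
        | Vec.lookup-map i isZero xs
        | Vec.lookup-map i pred xs = refl

stillUnbound-false : ∀ n x → stillUnbound n false x ≡ false
stillUnbound-false zero    x = refl
stillUnbound-false (suc n) x = stillUnbound-false n (pred x)

<⇒bound : ∀ {n x} → x < n → stillUnbound n true x ≡ false
<⇒bound {suc n} {zero}  _         = stillUnbound-false n zero
<⇒bound {suc n} {suc x} (s≤s x<n) = <⇒bound x<n

bound⇒< : ∀ n x → stillUnbound n true x ≡ false → x < n
bound⇒< (suc n) zero    _  = s≤s z≤n
bound⇒< (suc n) (suc x) eq = s≤s (bound⇒< n x eq)

-- Only the slots of the atom are tested. The padding slots hold 0, so the innermost quantifier
-- binds them if there is one and otherwise they stay unbound; neither matters, because they are
-- never gathered.
inScope : ∀ {m} → ℕ → Vec Bool (suc m) → Bool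
inScope r ps = not (anyTrue (gather r ps))

module _ {m : ℕ} (qs : List Quantifier) (xs : Vec ℕ (suc m)) where
  private
    ps = proj₂ (bindAll qs xs (unbound (suc m)))

    ps-lookup : ∀ i → Vec.lookup ps i ≡ stillUnbound (length qs) true (Vec.lookup xs i)
    ps-lookup i = ≡.trans (lookup-bindAll qs xs (unbound (suc m)) i)
      (cong (λ p → stillUnbound (length qs) p (Vec.lookup xs i)) (Vec.lookup-replicate i true))

  inScope⁺ : ∀ r → All (_< length qs) (gather r xs) → inScope r ps ≡ true
  inScope⁺ zero    []        = refl
  inScope⁺ (suc r) (x< ∷ xs<)
    rewrite ps-lookup (clamp m r) | <⇒bound x< = inScope⁺ r xs<

  inScope⁻ : ∀ r → inScope r ps ≡ true → All (_< length qs) (gather r xs)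
  inScope⁻ zero    _  = []
  inScope⁻ (suc r) eq with Vec.lookup ps (clamp m r) in p-eq
  ... | false = bound⇒< _ _ (≡.trans (≡.sym (ps-lookup (clamp m r))) p-eq) ∷ inScope⁻ r eq

-- Truth of prefixed formulas from the table of closed atoms

module Valuation (S : Signature) (m : ℕ)
  (atomValue : RelSymbol S → Upto (Binding (suc m)) (suc m) → Bool) where

  val : ∀ {n} → Vec Quantifier n → Formula S n → Bool
  val Qs (atom R ys)  = atomValue R
    (proj₁ (bindAll (Vec.toList Qs) (store (Vec.map toℕ ys) (Vec.replicate (suc m) 0)) (unbound (suc m))))
  val Qs (φ ∧ ψ)     = val Qs φ Bool.∧ val Qs ψ
  val Qs (φ ∨ ψ)     = val Qs φ Bool.∨ val Qs ψ
  val Qs (quant Q φ) = val (Q ∷ Qs) φ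

module Semantics {ℓ} (em : ExcludedMiddle ℓ) (S : Signature) (B : Structure S ℓ) where

  D : Set ℓ
  D = Domain B

  ⟦_⟧ : Quantifier → (D → Set ℓ) → Set ℓ
  ⟦ ∀Q ⟧ P = (b : D) → P b
  ⟦ ∃Q ⟧ P = Σ[ b ∈ D ] P b

  ≡⇒⇔ : {P P′ : Set ℓ} → P ≡ P′ → P ⇔ P′
  ≡⇒⇔ refl = ⇔-refl

  ⟦⟧-map : ∀ Q {P P′ : D → Set ℓ} → (∀ b → P b → P′ b) → ⟦ Q ⟧ P → ⟦ Q ⟧ P′
  ⟦⟧-map ∀Q f p       = λ b → f b (p b)
  ⟦⟧-map ∃Q f (b , p) = b , f b p

  ⟦⟧-cong : ∀ Q {P P′ : D → Set ℓ} → (∀ b → P b ⇔ P′ b) → ⟦ Q ⟧ P ⇔ ⟦ Q ⟧ P′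
  ⟦⟧-cong Q f = mk⇔ (⟦⟧-map Q (Equivalence.to ∘ f)) (⟦⟧-map Q (Equivalence.from ∘ f))

  ⟦⟧-vacuous : ∀ Q {P : Set ℓ} → ⟦ Q ⟧ (λ _ → P) ⇔ P
  ⟦⟧-vacuous ∀Q = mk⇔ (λ f → f (nonempty B)) (λ p _ → p)
  ⟦⟧-vacuous ∃Q = mk⇔ proj₂ (nonempty B ,_)

  quantify : List Quantifier → (List D → Set ℓ) → Set ℓ
  quantify []       P = P []
  quantify (Q ∷ qs) P = quantify qs λ ρ → ⟦ Q ⟧ λ b → P (b ∷ ρ)

  quantify-cong : ∀ qs {P P′ : List D → Set ℓ} → (∀ ρ → P ρ ⇔ P′ ρ) → quantify qs P ⇔ quantify qs P′
  quantify-cong []       f = f []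
  quantify-cong (Q ∷ qs) f = quantify-cong qs λ ρ → ⟦⟧-cong Q λ b → f (b ∷ ρ)

  sat-quant : ∀ {n} Q {φ : Formula S (suc n)} (ρ : Vec D n) →
              Sat B ρ (quant Q φ) ⇔ ⟦ Q ⟧ λ b → Sat B (b ∷ ρ) φ
  sat-quant ∀Q ρ = ⇔-refl
  sat-quant ∃Q ρ = ⇔-refl

  prefix-quantify : ∀ {k} (Qs : Vec Quantifier k) {φ} {P : List D → Set ℓ} →
    (∀ ρ → Sat B ρ φ ⇔ P (Vec.toList ρ)) → (B ⊨ prefix Qs φ) ⇔ quantify (Vec.toList Qs) P
  prefix-quantify []       f = f []
  prefix-quantify (Q ∷ Qs) f =
    prefix-quantify Qs λ ρ → ⇔-trans (sat-quant Q ρ) (⟦⟧-cong Q λ b → f (b ∷ ρ))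

  prefix-map : ∀ {k} (Qs : Vec Quantifier k) {φ ψ} → (∀ ρ → Sat B ρ φ → Sat B ρ ψ) →
               B ⊨ prefix Qs φ → B ⊨ prefix Qs ψ
  prefix-map []       f = f []
  prefix-map (Q ∷ Qs) f = prefix-map Qs λ ρ →
    Equivalence.from (sat-quant Q ρ) ∘ ⟦⟧-map Q (λ b → f (b ∷ ρ)) ∘ Equivalence.to (sat-quant Q ρ)

  module _ {m : ℕ} where

    Closed : RelSymbol S → List (Binding (suc m)) → Vec D (suc m) → Set ℓ
    Closed R []            g = rel B R (gather (arity S R) g)
    Closed R ((Q , Z) ∷ c) g = ⟦ Q ⟧ λ b → Closed R c (assign Z b g)

    -- Induction from the innermost quantifier outwards, `c` being the part of the prefix already
    -- closed over the atom. A quantifier that hits an unbound slot is moved to the front of `c`;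
    -- one that hits none ranges over a constant proposition and is dropped. The hypothesis reserves
    -- a place in `Upto` for each slot still unbound.
    bindAll-correct : ∀ R qs xs c ps g → length (toList (suc m) c) + count ps ≤ suc m →
      quantify qs (λ ρ → Closed R (toList (suc m) c) (fill ps xs ρ g)) ⇔
      Closed R (toList (suc m) (proj₁ (bindAll qs xs (c , ps)))) g
    bindAll-correct R []       xs c ps g l≤ rewrite fill-[] ps xs g = ⇔-refl
    bindAll-correct R (Q ∷ qs) xs c ps g l≤ with anyTrue (hits ps (Vec.map isZero xs)) in hit
    ... | true  = ⇔-trans (quantify-cong qs λ ρ → step ρ)
                          (bindAll-correct R qs _ _ _ g l≤′)
      where
      zs = Vec.map isZero xs
      ps′< = count-misses< ps zs hit
      pushed = toList-push (suc m) (Q , hits ps zs) c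
        (ℕ.≤-trans (ℕ.≤-reflexive (≡.sym (ℕ.+-comm _ 1)))
          (ℕ.≤-trans (ℕ.+-monoʳ-≤ _ (ℕ.≤-trans (s≤s z≤n) ps′<)) l≤))
      l≤′ : length (toList (suc m) (push (suc m) (Q , hits ps zs) c)) + count (misses ps zs) ≤ suc m
      l≤′ = subst (λ l → length l + count (misses ps zs) ≤ suc m) (≡.sym pushed)
        (ℕ.≤-trans (ℕ.≤-reflexive (≡.sym (ℕ.+-suc _ _)))
          (ℕ.≤-trans (ℕ.+-monoʳ-≤ (length (toList (suc m) c)) ps′<) l≤))
      step : ∀ ρ → ⟦ Q ⟧ (λ b → Closed R (toList (suc m) c) (fill ps xs (b ∷ ρ) g)) ⇔
             Closed R (toList (suc m) (push (suc m) (Q , hits ps zs) c))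
               (fill (misses ps zs) (Vec.map pred xs) ρ g)
      step ρ = ⇔-trans
        (⟦⟧-cong Q λ b → ≡⇒⇔ (cong (Closed R (toList (suc m) c)) (fill-∷ ps xs b ρ g)))
        (≡⇒⇔ (cong (λ l → Closed R l (fill (misses ps zs) (Vec.map pred xs) ρ g)) (≡.sym pushed)))
    ... | false = ⇔-trans (quantify-cong qs λ ρ → step ρ)
                          (bindAll-correct R qs _ _ _ g
                            (ℕ.≤-trans (ℕ.+-monoʳ-≤ _ (count-misses≤ ps zs)) l≤))
      where
      zs = Vec.map isZero xs
      step : ∀ ρ → ⟦ Q ⟧ (λ b → Closed R (toList (suc m) c) (fill ps xs (b ∷ ρ) g)) ⇔
             Closed R (toList (suc m) c) (fill (misses ps zs) (Vec.map pred xs) ρ g)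
      step ρ = ⇔-trans
        (⟦⟧-cong Q λ b → ≡⇒⇔ (cong (Closed R (toList (suc m) c))
          (≡.trans (fill-∷ ps xs b ρ g) (assign-nothing (hits ps zs) b _ hit))))
        (⟦⟧-vacuous Q)

    atomValue : RelSymbol S → Upto (Binding (suc m)) (suc m) → Bool
    -- For an atom in scope every gathered slot gets assigned by a quantifier, so the starting
    -- contents are arbitrary; `nonempty` provides some.
    atomValue R c = does (em {Closed R (toList (suc m) c) (Vec.replicate (suc m) (nonempty B))})

    atomValue-reflects : ∀ {k} (Qs : Vec Quantifier k) R ys {xs} →
      gather (arity S R) xs ≡ Vec.map toℕ ys → Reflects (B ⊨ prefix Qs (atom R ys))
        (atomValue R (proj₁ (bindAll (Vec.toList Qs) xs (unbound (suc m)))))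
    atomValue-reflects Qs R ys {xs} eq =
      reflects-⇔ (⇔-sym (⇔-trans (prefix-quantify Qs atom-fill)
                   (bindAll-correct R (Vec.toList Qs) xs (none (suc m)) (Vec.replicate (suc m) true)
                      (Vec.replicate (suc m) (nonempty B)) (count≤ (Vec.replicate (suc m) true)))))
                 (proof em)
      where
      reflects-⇔ : ∀ {P P′ : Set ℓ} {b} → P ⇔ P′ → Reflects P b → Reflects P′ b
      reflects-⇔ f (ofʸ p)  = ofʸ (Equivalence.to f p)
      reflects-⇔ f (ofⁿ ¬p) = ofⁿ (¬p ∘ Equivalence.from f)

      g : Vec D (suc m)
      g = Vec.replicate (suc m) (nonempty B)

      gather-fill : ∀ {n r} (ρ : Vec D n) (ys : Vec (Fin n) r) → gather r xs ≡ Vec.map toℕ ys →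
        Vec.map (Vec.lookup ρ) ys ≡ gather r (fill (Vec.replicate (suc m) true) xs (Vec.toList ρ) g)
      gather-fill ρ []       eq = refl
      gather-fill {r = suc r} ρ (y ∷ ys) eq = cong₂ _∷_
        (≡.sym (≡.trans (lookup-fill xs (Vec.toList ρ) g (clamp m r))
          (≡.trans (cong (λ x → nth (Vec.toList ρ) x _) (Vec.∷-injectiveˡ eq)) (nth-lookup ρ y _))))
        (gather-fill ρ ys (Vec.∷-injectiveʳ eq))

      atom-fill : ∀ ρ → Sat B ρ (atom R ys) ⇔
        Closed R [] (fill (Vec.replicate (suc m) true) xs (Vec.toList ρ) g)
      atom-fill ρ = ≡⇒⇔ (cong (rel B R) (gather-fill ρ ys eq))

    module _ (arity≤ : ∀ R → arity S R ≤ m)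
             (¬breaks∧ : ¬ ∃ λ φ → Breaks∧ B φ) (¬breaks∨ : ¬ ∃ λ ψ → Breaks∨ B ψ) where

      open Valuation S m atomValue using (val)

      -- Half of each case is monotonicity of the prefix. The other half uses that nothing breaks
      -- the connective: for ∧ this only refutes the failure of the closed conjunction, so excluded
      -- middle is applied, while for ∨ the goal is itself a negation.
      val-reflects : ∀ {n} (Qs : Vec Quantifier n) φ → Reflects (B ⊨ prefix Qs φ) (val Qs φ)
      val-reflects Qs (atom R ys) = atomValue-reflects Qs R ys (gather-zeros-store (Vec.map toℕ ys) (arity≤ R))
      val-reflects Qs (φ ∧ ψ) with val Qs φ | val Qs ψ | val-reflects Qs φ | val-reflects Qs ψ
      ... | false | _     | ofⁿ ¬p | _      = ofⁿ (¬p ∘ prefix-map Qs (λ _ → proj₁))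
      ... | true  | false | _      | ofⁿ ¬q = ofⁿ (¬q ∘ prefix-map Qs (λ _ → proj₂))
      ... | true  | true  | ofʸ p  | ofʸ q  with em {B ⊨ prefix Qs (φ ∧ ψ)}
      ...   | yes pq = ofʸ pq
      ...   | no ¬pq = ⊥-elim (¬breaks∧ (_ , _ , Qs , φ , ψ , refl , ¬pq , p , q))
      val-reflects Qs (φ ∨ ψ) with val Qs φ | val Qs ψ | val-reflects Qs φ | val-reflects Qs ψ
      ... | true  | _     | ofʸ p  | _      = ofʸ (prefix-map Qs (λ _ → inj₁) p)
      ... | false | true  | _      | ofʸ q  = ofʸ (prefix-map Qs (λ _ → inj₂) q)
      ... | false | false | ofⁿ ¬p | ofⁿ ¬q =
        ofⁿ λ pq → ¬breaks∨ (_ , _ , Qs , φ , ψ , refl , pq , ¬p , ¬q)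
      val-reflects Qs (quant Q φ) = val-reflects (Q ∷ Qs) φ

-- Evaluation with a stack of frames

-- The part of the context of a subformula that matters: the quantifiers above
-- it, and the connectives (true for ∧) of which it lies in the left operand.
data Frame : Set where
  binder  : Quantifier → Frame
  operand : Bool → Frame

quants : List Frame → List Quantifier
quants []              = []
quants (binder Q ∷ Γ)  = Q ∷ quants Γ
quants (operand _ ∷ Γ) = quants Γ

pop : List Frame → List Frame
pop []              = []
pop (binder _ ∷ Γ)  = pop Γ
pop (operand _ ∷ Γ) = Γ

-- In mode `skip v` a number of subformulas, kept in a counter, is passed over
-- because v is already known to be the value of the disjunction or conjunction
-- around them.
Mode : Set
Mode = Maybe Bool

pattern active = nothing
pattern skip v = just v

-- The nearest connective and whether all those seen so far agree with it.
Trend : Set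
Trend = Maybe (Bool × Bool)

-- With ∧ coded as `true`, one test serves two purposes: connectives agree when they are equal, and
-- a value agrees with a connective when it is neutral for it, so that a left operand decides
-- exactly when it disagrees.
agree : Bool → Bool → Bool
agree true  b = b
agree false b = not b

observe : Bool → Trend → Trend × Bool
observe o nothing              = just (o , true) , true
observe o (just (o′ , true))   = just (o′ , agree o′ o) , agree o′ o
observe o (just (o′ , false))  = just (o′ , false) , false

countOp : Mode → Bool → Op
countOp active true = inc
countOp _      _    = hold

-- When the skip count reaches zero, the run of connectives decided by `v` is over and the nearest
-- one left is of the other kind. There `v` is neutral, so its right operand is evaluated without
-- looking at `v`; if none is left, `v` is the verdict.
decide : Mode → Trend → Bool → Bool → Mode ⊎ Bool
decide (skip v) nothing        _     _ = inj₂ v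
decide (skip v) (just _)       true  _ = inj₁ active
decide (skip v) (just _)       false _ = inj₁ (skip v)
decide active   nothing        _     b = inj₂ b
decide active   (just (o , _)) _     b = inj₁ (if agree o b then active else skip b)

onSkip : Mode → Op → Op
onSkip active   _  = hold
onSkip (skip _) op = op

scan : Mode → Trend → ℕ → List Frame → Trend × ℕ
scan μ i k []              = i , k
scan μ i k (binder _ ∷ Γ)  = scan μ i k Γ
scan μ i k (operand o ∷ Γ) =
  scan μ (proj₁ (observe o i)) (applyOp (countOp μ (proj₂ (observe o i))) k) Γ

scan-skip : ∀ v i k Γ → proj₂ (scan (skip v) i k Γ) ≡ k
scan-skip v i k []              = refl
scan-skip v i k (binder _ ∷ Γ)  = scan-skip v i k Γ
scan-skip v i k (operand o ∷ Γ) = scan-skip v (proj₁ (observe o i)) k Γ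

-- One-pass evaluation and recognition of encodings

module Recognition (S : Signature) (m : ℕ) (arity≤ : ∀ R → arity S R ≤ m)
  (atomValue : RelSymbol S → Upto (Binding (suc m)) (suc m) → Bool) where

  open Valuation S m atomValue

  Word : Set
  Word = List (Symbol S)

  zeros : Vec ℕ (suc m)
  zeros = Vec.replicate (suc m) 0

  bindings : List Frame → Vec ℕ (suc m) → Bindings (suc m)
  bindings Γ xs = bindAll (quants Γ) xs (unbound (suc m))

  ended : Bool → Word → Bool
  ended v []      = v
  ended v (_ ∷ _) = false

  runFormula : List Frame → Mode → ℕ → Word → Bool
  runArgs    : List Frame → Mode → ℕ → RelSymbol S → ℕ → Vec ℕ (suc m) → Word → Bool
  runAfter   : List Frame → Mode → ℕ → Bool → Word → Bool
  resume     : Mode ⊎ Bool → List Frame → ℕ → Word → Bool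

  runFormula Γ μ k (and ∷ w)          = runFormula (operand true ∷ Γ) μ (applyOp (onSkip μ inc) k) w
  runFormula Γ μ k (or ∷ w)           = runFormula (operand false ∷ Γ) μ (applyOp (onSkip μ inc) k) w
  runFormula Γ μ k (quantifier Q ∷ w) = runFormula (binder Q ∷ Γ) μ k w
  runFormula Γ μ k (relation R ∷ w)   = runArgs Γ μ (applyOp (onSkip μ dec) k) R (arity S R) zeros w
  runFormula Γ μ k _                  = false

  runArgs Γ μ k R zero    xs w            =
    if inScope (arity S R) (proj₂ (bindings Γ xs))
    then runAfter Γ μ k (atomValue R (proj₁ (bindings Γ xs))) w else false
  runArgs Γ μ k R (suc r) xs (stroke ∷ w) = runArgs Γ μ k R (suc r) (Vec.updateAt xs (clamp m r) suc) w
  runArgs Γ μ k R (suc r) xs (stop ∷ w)   = runArgs Γ μ k R r xs w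
  runArgs Γ μ k R (suc r) xs _            = false

  runAfter Γ μ k b w =
    resume (decide μ (proj₁ (scan μ nothing k Γ)) (isZero (proj₂ (scan μ nothing k Γ))) b)
           (pop Γ) (proj₂ (scan μ nothing k Γ)) w

  resume (inj₁ active)   Γ k w = runFormula Γ active 0 w
  resume (inj₁ (skip v)) Γ k w = runFormula Γ (skip v) k w
  resume (inj₂ v)        Γ k w = ended v w

  encodeArgs : ∀ {r} → Vec ℕ r → Word
  encodeArgs []       = []
  encodeArgs (x ∷ xs) = replicate x stroke ++ stop ∷ encodeArgs xs

  encodeVars≡encodeArgs : ∀ {n r} (ys : Vec (Fin n) r) → encodeVars ys ≡ encodeArgs (Vec.map toℕ ys)
  encodeVars≡encodeArgs []       = refl
  encodeVars≡encodeArgs (y ∷ ys) = cong (λ w → replicate (toℕ y) stroke ++ stop ∷ w) (encodeVars≡encodeArgs ys)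

  store-stop : ∀ {r} (zs : Vec ℕ r) (xs : Vec ℕ (suc m)) → store (0 ∷ zs) xs ≡ store zs xs
  store-stop {r} zs xs = cong (store zs) (Vec.updateAt-id-local (clamp m r) xs refl)

  store-stroke : ∀ {r} z (zs : Vec ℕ r) (xs : Vec ℕ (suc m)) →
                 store (z ∷ zs) (Vec.updateAt xs (clamp m r) suc) ≡ store (suc z ∷ zs) xs
  store-stroke {r} z zs xs =
    cong (store zs) (Vec.updateAt-updateAt-local (clamp m r) xs (ℕ.+-suc z _))

  runArgs-encode : ∀ Γ μ k R {r} (zs : Vec ℕ r) xs w →
    runArgs Γ μ k R r xs (encodeArgs zs ++ w) ≡ runArgs Γ μ k R 0 (store zs xs) w
  runArgs-encode Γ μ k R []           xs w = refl
  runArgs-encode Γ μ k R (zero ∷ zs)  xs w =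
    ≡.trans (runArgs-encode Γ μ k R zs xs w)
            (cong (λ ys → runArgs Γ μ k R 0 ys w) (≡.sym (store-stop zs xs)))
  runArgs-encode Γ μ k R (suc z ∷ zs) xs w =
    ≡.trans (runArgs-encode Γ μ k R (z ∷ zs) _ w)
            (cong (λ ys → runArgs Γ μ k R 0 ys w) (store-stroke z zs xs))

  all<-toℕ : ∀ {n r} (ys : Vec (Fin n) r) → All (_< n) (Vec.map toℕ ys)
  all<-toℕ []       = []
  all<-toℕ (y ∷ ys) = toℕ<n y ∷ all<-toℕ ys

  runFormula-atom : ∀ Γ μ k R (ys : Vec (Fin (length (quants Γ))) (arity S R)) w →
    runFormula Γ μ k (encode (atom R ys) ++ w) ≡
    runAfter Γ μ (applyOp (onSkip μ dec) k)
      (atomValue R (proj₁ (bindings Γ (store (Vec.map toℕ ys) zeros)))) w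
  runFormula-atom Γ μ k R ys w
    rewrite encodeVars≡encodeArgs ys
          | runArgs-encode Γ μ (applyOp (onSkip μ dec) k) R (Vec.map toℕ ys) zeros w
          | inScope⁺ (quants Γ) (store (Vec.map toℕ ys) zeros) (arity S R)
              (subst (All (_< length (quants Γ)))
                (≡.sym (gather-zeros-store (Vec.map toℕ ys) (arity≤ R))) (all<-toℕ ys)) = refl

  scan-just : ∀ μ o c k Γ → ∃[ c′ ] proj₁ (scan μ (just (o , c)) k Γ) ≡ just (o , c′)
  scan-just μ o c     k []               = c , refl
  scan-just μ o c     k (binder _ ∷ Γ)   = scan-just μ o c k Γ
  scan-just μ o true  k (operand o′ ∷ Γ) = scan-just μ o _ _ Γ
  scan-just μ o false k (operand o′ ∷ Γ) = scan-just μ o _ _ Γ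

  -- The number of pending connectives that fall together with a decided connective `o` just below
  -- `Γ`, hence of the further right operands to skip.
  run : Bool → List Frame → ℕ
  run o []               = 0
  run o (binder _ ∷ Γ)   = run o Γ
  run o (operand o′ ∷ Γ) = if agree o o′ then suc (run o Γ) else 0

  scan-closed : ∀ o k Γ → proj₂ (scan active (just (o , false)) k Γ) ≡ k
  scan-closed o k []              = refl
  scan-closed o k (binder _ ∷ Γ)  = scan-closed o k Γ
  scan-closed o k (operand _ ∷ Γ) = scan-closed o k Γ

  scan-open : ∀ o k Γ → proj₂ (scan active (just (o , true)) k Γ) ≡ k + run o Γ
  scan-open o k []               = ≡.sym (ℕ.+-identityʳ k)
  scan-open o k (binder _ ∷ Γ)   = scan-open o k Γ
  scan-open o k (operand o′ ∷ Γ) with agree o o′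
  ... | true  = ≡.trans (scan-open o (suc k) Γ) (≡.sym (ℕ.+-suc k (run o Γ)))
  ... | false = ≡.trans (scan-closed o k Γ) (≡.sym (ℕ.+-identityʳ k))

  runAfter-operand : ∀ o Γ b w → runAfter (operand o ∷ Γ) active 0 b w ≡
    (if agree o b then runFormula Γ active 0 w else runFormula Γ (skip b) (suc (run o Γ)) w)
  runAfter-operand o Γ b w
    rewrite proj₂ (scan-just active o true 1 Γ) | scan-open o 1 Γ with agree o b
  ... | true  = refl
  ... | false = refl

  runAfter-skip-suc : ∀ o Γ v k b w →
    runAfter (operand o ∷ Γ) (skip v) (suc k) b w ≡ runFormula Γ (skip v) (suc k) w
  runAfter-skip-suc o Γ v k b w
    rewrite proj₂ (scan-just (skip v) o true (suc k) Γ) | scan-skip v (just (o , true)) (suc k) Γ = refl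

  runAfter-skip-zero : ∀ o Γ v b w →
    runAfter (operand o ∷ Γ) (skip v) 0 b w ≡ runFormula Γ active 0 w
  runAfter-skip-zero o Γ v b w
    rewrite proj₂ (scan-just (skip v) o true 0 Γ) | scan-skip v (just (o , true)) 0 Γ = refl

  -- A value that decides the nearest connectives decides exactly the run of
  -- equal ones, so skipping their right operands is the same as evaluating.
  runAfter-absorb : ∀ Γ v w → runAfter Γ (skip v) (run (not v) Γ) true w ≡ runAfter Γ active 0 v w
  runAfter-absorb []                  v     w = refl
  runAfter-absorb (binder _ ∷ Γ)      v     w = runAfter-absorb Γ v w
  runAfter-absorb (operand true ∷ Γ)  true  w =
    ≡.trans (runAfter-skip-zero true Γ true true w) (≡.sym (runAfter-operand true Γ true w))
  runAfter-absorb (operand true ∷ Γ)  false w =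
    ≡.trans (runAfter-skip-suc true Γ false _ true w) (≡.sym (runAfter-operand true Γ false w))
  runAfter-absorb (operand false ∷ Γ) true  w =
    ≡.trans (runAfter-skip-suc false Γ true _ true w) (≡.sym (runAfter-operand false Γ true w))
  runAfter-absorb (operand false ∷ Γ) false w =
    ≡.trans (runAfter-skip-zero false Γ false true w) (≡.sym (runAfter-operand false Γ false w))

  runAfter-skip-value : ∀ Γ v k b w → runAfter Γ (skip v) k b w ≡ runAfter Γ (skip v) k true w
  runAfter-skip-value Γ v k b w
    with proj₁ (scan (skip v) nothing k Γ) | isZero (proj₂ (scan (skip v) nothing k Γ))
  ... | nothing | _     = refl
  ... | just _  | true  = refl
  ... | just _  | false = refl

  -- A binary connective replaces one awaited formula by two and an atom supplies one, so a whole
  -- formula lowers the count by one net. The count stays positive inside the formula, so skipping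
  -- cannot stop there.
  runFormula-skip : ∀ {n} (φ : Formula S n) Γ v k w → n ≡ length (quants Γ) →
    runFormula Γ (skip v) (suc k) (encode φ ++ w) ≡ runAfter Γ (skip v) k true w
  runFormula-skip (atom R ys) Γ v k w refl =
    ≡.trans (runFormula-atom Γ (skip v) (suc k) R ys w) (runAfter-skip-value Γ v k _ w)
  runFormula-skip (φ ∧ ψ) Γ v k w n≡
    rewrite List.++-assoc (encode φ) (encode ψ) w
          | runFormula-skip φ (operand true ∷ Γ) v (suc k) (encode ψ ++ w) n≡
          | runAfter-skip-suc true Γ v k true (encode ψ ++ w) = runFormula-skip ψ Γ v k w n≡
  runFormula-skip (φ ∨ ψ) Γ v k w n≡
    rewrite List.++-assoc (encode φ) (encode ψ) w
          | runFormula-skip φ (operand false ∷ Γ) v (suc k) (encode ψ ++ w) n≡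
          | runAfter-skip-suc false Γ v k true (encode ψ ++ w) = runFormula-skip ψ Γ v k w n≡
  runFormula-skip (quant Q φ) Γ v k w n≡ = runFormula-skip φ (binder Q ∷ Γ) v k w (cong suc n≡)

  runFormula-active : ∀ {n} (φ : Formula S n) (Qs : Vec Quantifier n) Γ w →
    n ≡ length (quants Γ) → Vec.toList Qs ≡ quants Γ →
    runFormula Γ active 0 (encode φ ++ w) ≡ runAfter Γ active 0 (val Qs φ) w
  runFormula-active (atom R ys) Qs Γ w refl eq rewrite eq = runFormula-atom Γ active 0 R ys w
  runFormula-active (φ ∧ ψ) Qs Γ w n≡ eq
    rewrite List.++-assoc (encode φ) (encode ψ) w
          | runFormula-active φ Qs (operand true ∷ Γ) (encode ψ ++ w) n≡ eq
          | runAfter-operand true Γ (val Qs φ) (encode ψ ++ w) with val Qs φ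
  ... | true  = runFormula-active ψ Qs Γ w n≡ eq
  ... | false = ≡.trans (runFormula-skip ψ Γ false _ w n≡) (runAfter-absorb Γ false w)
  runFormula-active (φ ∨ ψ) Qs Γ w n≡ eq
    rewrite List.++-assoc (encode φ) (encode ψ) w
          | runFormula-active φ Qs (operand false ∷ Γ) (encode ψ ++ w) n≡ eq
          | runAfter-operand false Γ (val Qs φ) (encode ψ ++ w) with val Qs φ
  ... | false = runFormula-active ψ Qs Γ w n≡ eq
  ... | true  = ≡.trans (runFormula-skip ψ Γ true _ w n≡) (runAfter-absorb Γ true w)
  runFormula-active (quant Q φ) Qs Γ w n≡ eq =
    runFormula-active φ (Q ∷ Qs) (binder Q ∷ Γ) w (cong suc n≡) (cong (Q ∷_) eq)

  runFormula-encode : ∀ θ → runFormula [] active 0 (encode θ) ≡ val [] θ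
  runFormula-encode θ = ≡.trans (cong (runFormula [] active 0) (≡.sym (List.++-identityʳ (encode θ))))
                                (runFormula-active θ [] [] [] refl refl)

  -- Needs Γ w: w consists of a formula for the current position, followed by
  -- the right operands that the context Γ still lacks.
  data Needs (Γ : List Frame) : Word → Set
  data Lacks : List Frame → Word → Set

  data Needs Γ where
    needs : ∀ {w} (φ : Formula S (length (quants Γ))) → Lacks Γ w → Needs Γ (encode φ ++ w)

  data Lacks where
    []      : Lacks [] []
    binder  : ∀ {Q Γ w} → Lacks Γ w → Lacks (binder Q ∷ Γ) w
    operand : ∀ {o Γ w} → Needs Γ w → Lacks (operand o ∷ Γ) w

  data TakesArgs (Γ : List Frame) (R : RelSymbol S) (r : ℕ) (xs : Vec ℕ (suc m)) : Word → Set where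
    takesArgs : ∀ {w} (zs : Vec ℕ r) → inScope (arity S R) (proj₂ (bindings Γ (store zs xs))) ≡ true →
                Lacks Γ w → TakesArgs Γ R r xs (encodeArgs zs ++ w)

  takes-stop : ∀ {Γ R r xs w} → TakesArgs Γ R r xs w → TakesArgs Γ R (suc r) xs (stop ∷ w)
  takes-stop {Γ} {R} {xs = xs} (takesArgs zs ok l) = takesArgs (0 ∷ zs)
    (subst (λ ys → inScope (arity S R) (proj₂ (bindings Γ ys)) ≡ true) (≡.sym (store-stop zs xs)) ok) l

  takes-stroke : ∀ {Γ R r xs w} → TakesArgs Γ R (suc r) (Vec.updateAt xs (clamp m r) suc) w →
                 TakesArgs Γ R (suc r) xs (stroke ∷ w)
  takes-stroke {Γ} {R} {xs = xs} (takesArgs (z ∷ zs) ok l) = takesArgs (suc z ∷ zs)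
    (subst (λ ys → inScope (arity S R) (proj₂ (bindings Γ ys)) ≡ true) (store-stroke z zs xs) ok) l

  all<-fromℕ : ∀ {n r} {zs : Vec ℕ r} → All (_< n) zs → ∃[ ys ] Vec.map (toℕ {n}) ys ≡ zs
  all<-fromℕ []         = [] , refl
  all<-fromℕ (z< ∷ zs<) with all<-fromℕ zs<
  ... | ys , eq = fromℕ< z< ∷ ys , cong₂ _∷_ (toℕ-fromℕ< z<) eq

  needs-atom : ∀ {Γ R w} → TakesArgs Γ R (arity S R) zeros w → Needs Γ (relation R ∷ w)
  needs-atom {Γ} {R} (takesArgs zs ok l) with all<-fromℕ
    (subst (All (_< length (quants Γ))) (gather-zeros-store zs (arity≤ R))
      (inScope⁻ (quants Γ) (store zs zeros) (arity S R) ok))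
  ... | ys , refl =
    subst (λ v → Needs Γ (relation R ∷ v ++ _)) (encodeVars≡encodeArgs ys) (needs (atom R ys) l)

  needs-connective : ∀ {Γ o w} (_⊙_ : ∀ {n} → Formula S n → Formula S n → Formula S n) s →
    (∀ {n} (φ ψ : Formula S n) → encode (φ ⊙ ψ) ≡ s ∷ encode φ ++ encode ψ) →
    Needs (operand o ∷ Γ) w → Needs Γ (s ∷ w)
  needs-connective {Γ} _⊙_ s eq (needs φ (operand (needs {w} ψ l))) = subst (Needs Γ)
    (≡.trans (cong (_++ w) (eq φ ψ)) (cong (s ∷_) (List.++-assoc (encode φ) (encode ψ) w)))
    (needs (φ ⊙ ψ) l)

  needs-quant : ∀ {Γ Q w} → Needs (binder Q ∷ Γ) w → Needs Γ (quantifier Q ∷ w)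
  needs-quant {Q = Q} (needs φ (binder l)) = needs (quant Q φ) l

  -- How the remaining word parses depends on neither mode nor count, so recovering a parse from
  -- acceptance needs only that some mode and count continue the run.
  runAfter-resumes : ∀ o Γ μ k b w → runAfter (operand o ∷ Γ) μ k b w ≡ true →
                     ∃[ μ′ ] ∃[ k′ ] runFormula Γ μ′ k′ w ≡ true
  runAfter-resumes o Γ active k b w eq
    rewrite proj₂ (scan-just active o true (suc k) Γ) with agree o b
  ... | true  = _ , _ , eq
  ... | false = _ , _ , eq
  runAfter-resumes o Γ (skip v) k b w eq
    rewrite proj₂ (scan-just (skip v) o true k Γ)
    with isZero (proj₂ (scan (skip v) (just (o , true)) k Γ))
  ... | true  = _ , _ , eq
  ... | false = _ , _ , eq

  accepted-formula : ∀ Γ μ k w → runFormula Γ μ k w ≡ true → Needs Γ w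
  accepted-args : ∀ Γ μ k R r xs w → runArgs Γ μ k R r xs w ≡ true → TakesArgs Γ R r xs w
  accepted-after : ∀ Γ μ k b w → runAfter Γ μ k b w ≡ true → Lacks Γ w

  accepted-formula Γ μ k (and ∷ w) eq =
    needs-connective _∧_ and (λ _ _ → refl) (accepted-formula (operand true ∷ Γ) μ _ w eq)
  accepted-formula Γ μ k (or ∷ w) eq =
    needs-connective _∨_ or (λ _ _ → refl) (accepted-formula (operand false ∷ Γ) μ _ w eq)
  accepted-formula Γ μ k (quantifier Q ∷ w) eq = needs-quant (accepted-formula (binder Q ∷ Γ) μ k w eq)
  accepted-formula Γ μ k (relation R ∷ w)   eq = needs-atom (accepted-args Γ μ _ R _ zeros w eq)

  accepted-args Γ μ k R zero xs w eq with inScope (arity S R) (proj₂ (bindings Γ xs)) in ok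
  ... | true = takesArgs [] ok (accepted-after Γ μ k _ w eq)
  accepted-args Γ μ k R (suc r) xs (stroke ∷ w) eq = takes-stroke (accepted-args Γ μ k R (suc r) _ w eq)
  accepted-args Γ μ k R (suc r) xs (stop ∷ w)   eq = takes-stop (accepted-args Γ μ k R r xs w eq)

  accepted-after []              active   k b []      eq = []
  accepted-after []              (skip v) k b []      eq = []
  accepted-after []              active   k b (_ ∷ _) ()
  accepted-after []              (skip v) k b (_ ∷ _) ()
  accepted-after (binder Q ∷ Γ)  μ        k b w       eq = binder (accepted-after Γ μ k b w eq)
  accepted-after (operand o ∷ Γ) μ        k b w       eq with runAfter-resumes o Γ μ k b w eq
  ... | μ′ , k′ , eq′ = operand (accepted-formula Γ μ′ k′ w eq′)

  accepted-sentence : ∀ w → runFormula [] active 0 w ≡ true → ∃[ θ ] w ≡ encode θ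
  accepted-sentence w eq with accepted-formula [] active 0 w eq
  ... | needs θ [] = θ , List.++-identityʳ (encode θ)

-- The counter machine

finite-Quantifier : Finite Quantifier
finite-Quantifier = finite-↔ (mk↔ₛ′ (λ { ∀Q → false ; ∃Q → true }) (λ { false → ∀Q ; true → ∃Q })
  (λ { false → refl ; true → refl }) (λ { ∀Q → refl ; ∃Q → refl })) finite-Bool

finite-Symbol : ∀ S → Finite (Symbol S)
finite-Symbol S = finite-↔ Symbol↔
  (finite-⊎ (finite-Fin 4) (finite-⊎ finite-Quantifier (finite-Fin (size S))))
  where
  Symbol↔ : Symbol S ↔ (Fin 4 ⊎ (Quantifier ⊎ RelSymbol S))
  Symbol↔ = mk↔ₛ′
    (λ { and → inj₁ zero ; or → inj₁ (suc zero)
       ; stroke → inj₁ (suc (suc zero)) ; stop → inj₁ (suc (suc (suc zero)))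
       ; (quantifier Q) → inj₂ (inj₁ Q) ; (relation R) → inj₂ (inj₂ R) })
    (λ { (inj₁ zero) → and ; (inj₁ (suc zero)) → or
       ; (inj₁ (suc (suc zero))) → stroke ; (inj₁ (suc (suc (suc zero)))) → stop
       ; (inj₂ (inj₁ Q)) → quantifier Q ; (inj₂ (inj₂ R)) → relation R })
    (λ { (inj₁ zero) → refl ; (inj₁ (suc zero)) → refl
       ; (inj₁ (suc (suc zero))) → refl ; (inj₁ (suc (suc (suc zero)))) → refl
       ; (inj₂ (inj₁ Q)) → refl ; (inj₂ (inj₂ R)) → refl })
    (λ { and → refl ; or → refl ; stroke → refl ; stop → refl
       ; (quantifier Q) → refl ; (relation R) → refl })

-- Effects of counter operations and bounds on the counters

zipWith-hold : ∀ {n} (xs : Vec ℕ n) → Vec.zipWith applyOp (Vec.replicate n hold) xs ≡ xs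
zipWith-hold []       = refl
zipWith-hold (x ∷ xs) = cong (x ∷_) (zipWith-hold xs)

zipWith-dec : ∀ {n} (xs : Vec ℕ n) → Vec.zipWith applyOp (Vec.replicate n dec) xs ≡ Vec.map pred xs
zipWith-dec []       = refl
zipWith-dec (x ∷ xs) = cong (pred x ∷_) (zipWith-dec xs)

incAt : ∀ {n} → Fin n → Vec Op n
incAt {n} i = Vec.updateAt (Vec.replicate n hold) i (λ _ → inc)

zipWith-incAt : ∀ {n} (i : Fin n) xs → Vec.zipWith applyOp (incAt i) xs ≡ Vec.updateAt xs i suc
zipWith-incAt zero    (x ∷ xs) = cong (suc x ∷_) (zipWith-hold xs)
zipWith-incAt (suc i) (x ∷ xs) = cong (x ∷_) (zipWith-incAt i xs)

all≤-updateAt : ∀ {n N} (i : Fin n) {xs} → All (_≤ N) xs → All (_≤ suc N) (Vec.updateAt xs i suc)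
all≤-updateAt zero    (x≤ ∷ xs≤) = s≤s x≤ ∷ All.map ℕ.m≤n⇒m≤1+n xs≤
all≤-updateAt (suc i) (x≤ ∷ xs≤) = ℕ.m≤n⇒m≤1+n x≤ ∷ all≤-updateAt i xs≤

all≤-zeros : ∀ n {N} → All (_≤ N) (Vec.replicate n 0)
all≤-zeros zero    = []
all≤-zeros (suc n) = z≤n ∷ all≤-zeros n

all≤-pred : ∀ {n N} {xs : Vec ℕ n} → All (_≤ suc N) xs → All (_≤ N) (Vec.map pred xs)
all≤-pred []         = []
all≤-pred (x≤ ∷ xs≤) = ℕ.pred-mono-≤ x≤ ∷ all≤-pred xs≤

all≤0 : ∀ {n} {xs : Vec ℕ n} → All (_≤ 0) xs → xs ≡ Vec.replicate n 0
all≤0 []          = refl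
all≤0 (z≤n ∷ xs≤) = cong (0 ∷_) (all≤0 xs≤)

scan-bound : ∀ μ i k Γ → proj₂ (scan μ i k Γ) ≤ k + length Γ
scan-bound μ i k []              = ℕ.≤-reflexive (≡.sym (ℕ.+-identityʳ k))
scan-bound μ i k (binder _ ∷ Γ)  =
  ℕ.≤-trans (scan-bound μ i k Γ) (ℕ.+-monoʳ-≤ k (ℕ.n≤1+n _))
scan-bound μ i k (operand o ∷ Γ) = ℕ.≤-trans (scan-bound μ (proj₁ (observe o i)) _ Γ)
  (ℕ.≤-trans (ℕ.+-monoˡ-≤ (length Γ) (countOp≤ μ (proj₂ (observe o i))))
             (ℕ.≤-reflexive (≡.sym (ℕ.+-suc k (length Γ)))))
  where
  countOp≤ : ∀ μ b → applyOp (countOp μ b) k ≤ suc k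
  countOp≤ active   true  = ℕ.≤-refl
  countOp≤ active   false = ℕ.n≤1+n k
  countOp≤ (skip _) _     = ℕ.n≤1+n k

scan-≥ : ∀ μ i k Γ → k ≤ proj₂ (scan μ i k Γ)
scan-≥ μ i k []              = ℕ.≤-refl
scan-≥ μ i k (binder _ ∷ Γ)  = scan-≥ μ i k Γ
scan-≥ μ i k (operand o ∷ Γ) =
  ℕ.≤-trans (≤countOp μ (proj₂ (observe o i))) (scan-≥ μ (proj₁ (observe o i)) _ Γ)
  where
  ≤countOp : ∀ μ b → k ≤ applyOp (countOp μ b) k
  ≤countOp active   true  = ℕ.n≤1+n k
  ≤countOp active   false = ℕ.≤-refl
  ≤countOp (skip _) _     = ℕ.≤-refl

-- In active mode the counter has to be exactly zero, because the next scan counts a run of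
-- connectives in it from scratch.
ModeBound : Mode → ℕ → ℕ → Set
ModeBound active   k l = k ≡ 0
ModeBound (skip _) k l = k ≤ l

modeBound-≤ : ∀ μ {k l} → ModeBound μ k l → k ≤ l
modeBound-≤ active   refl = z≤n
modeBound-≤ (skip _) k≤l  = k≤l

modeBound-suc : ∀ μ {k l} → ModeBound μ k l → ModeBound μ k (suc l)
modeBound-suc active   k≡0 = k≡0
modeBound-suc (skip _) k≤l = ℕ.m≤n⇒m≤1+n k≤l

modeBound-inc : ∀ μ {k l} → ModeBound μ k l → ModeBound μ (applyOp (onSkip μ inc) k) (suc l)
modeBound-inc active   k≡0 = k≡0
modeBound-inc (skip _) k≤l = s≤s k≤l

modeBound-dec : ∀ μ {k l} → ModeBound μ k l → ModeBound μ (applyOp (onSkip μ dec) k) l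
modeBound-dec active   k≡0 = k≡0
modeBound-dec (skip _) k≤l = ℕ.≤-trans ℕ.pred[n]≤n k≤l

scan-modeBound : ∀ μ {k l} Γ → ModeBound μ k l → length Γ ≤ l → proj₂ (scan μ nothing k Γ) ≤ l
scan-modeBound active   Γ refl Γ≤ = ℕ.≤-trans (scan-bound active nothing 0 Γ) Γ≤
scan-modeBound (skip v) Γ k≤   Γ≤ = ℕ.≤-trans (ℕ.≤-reflexive (scan-skip v nothing _ Γ)) k≤

-- In active mode the run is counted before the value of the atom is known, since that value depends
-- on all frames. If the value turns out neutral, the count is unwanted and is removed in `p` steps
-- of the way back.
clear : Mode ⊎ Bool → ℕ → ℕ → ℕ
clear (inj₁ active)   p k = k ∸ p
clear (inj₁ (skip _)) p k = k
clear (inj₂ _)        p k = k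

clear-zero : ∀ n k → clear n 0 k ≡ k
clear-zero (inj₁ active)   k = refl
clear-zero (inj₁ (skip _)) k = refl
clear-zero (inj₂ _)        k = refl

clearOp : Mode ⊎ Bool → Op
clearOp (inj₁ active)   = dec
clearOp (inj₁ (skip _)) = hold
clearOp (inj₂ _)        = hold

clearOp-≤ : ∀ n k → applyOp (clearOp n) k ≤ k
clearOp-≤ (inj₁ active)   k = ℕ.pred[n]≤n
clearOp-≤ (inj₁ (skip _)) k = ℕ.≤-refl
clearOp-≤ (inj₂ _)        k = ℕ.≤-refl

clear-suc : ∀ n p k → clear n (suc p) k ≡ clear n p (applyOp (clearOp n) k)
clear-suc (inj₁ active)   p zero    = ≡.sym (ℕ.0∸n≡0 p)
clear-suc (inj₁ active)   p (suc k) = refl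
clear-suc (inj₁ (skip _)) p k       = refl
clear-suc (inj₂ _)        p k       = refl

-- The program and its states

module Program (S : Signature) (m : ℕ) (arity≤ : ∀ R → arity S R ≤ m)
  (atomValue : RelSymbol S → Upto (Binding (suc m)) (suc m) → Bool) where

  open Recognition S m arity≤ atomValue

  -- The frames above a position, from the reversed word u before it, when d
  -- complete formulas to the right of u still await their connective.
  walk : ℕ → Word → List Frame
  walk d       []                 = []
  walk d       (relation R ∷ u)   = walk (suc d) u
  walk d       (stroke ∷ u)       = walk d u
  walk d       (stop ∷ u)         = walk d u
  walk zero    (and ∷ u)          = operand true ∷ walk zero u
  walk (suc d) (and ∷ u)          = walk d u
  walk zero    (or ∷ u)           = operand false ∷ walk zero u
  walk (suc d) (or ∷ u)           = walk d u
  walk zero    (quantifier Q ∷ u) = binder Q ∷ walk zero u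
  walk (suc d) (quantifier Q ∷ u) = walk (suc d) u

  -- One more finished formula is the left operand of the nearest pending connective. The binders
  -- met before that connective lie inside the finished operand, and the connective itself is now
  -- being read on its right; `pop` discards just these frames.
  walk-suc : ∀ d u → walk (suc d) u ≡ pop (walk d u)
  walk-suc d       []                 = refl
  walk-suc zero    (and ∷ u)          = refl
  walk-suc (suc d) (and ∷ u)          = walk-suc d u
  walk-suc zero    (or ∷ u)           = refl
  walk-suc (suc d) (or ∷ u)           = walk-suc d u
  walk-suc zero    (quantifier Q ∷ u) = walk-suc zero u
  walk-suc (suc d) (quantifier Q ∷ u) = walk-suc (suc d) u
  walk-suc d       (relation R ∷ u)   = walk-suc (suc d) u
  walk-suc d       (stroke ∷ u)       = walk-suc d u
  walk-suc d       (stop ∷ u)         = walk-suc d u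

  length-walk : ∀ d u → length (walk d u) ≤ length u
  length-walk d       []                 = z≤n
  length-walk zero    (and ∷ u)          = s≤s (length-walk zero u)
  length-walk (suc d) (and ∷ u)          = ℕ.m≤n⇒m≤1+n (length-walk d u)
  length-walk zero    (or ∷ u)           = s≤s (length-walk zero u)
  length-walk (suc d) (or ∷ u)           = ℕ.m≤n⇒m≤1+n (length-walk d u)
  length-walk zero    (quantifier Q ∷ u) = s≤s (length-walk zero u)
  length-walk (suc d) (quantifier Q ∷ u) = ℕ.m≤n⇒m≤1+n (length-walk (suc d) u)
  length-walk d       (relation R ∷ u)   = ℕ.m≤n⇒m≤1+n (length-walk (suc d) u)
  length-walk d       (stroke ∷ u)       = ℕ.m≤n⇒m≤1+n (length-walk d u)
  length-walk d       (stop ∷ u)         = ℕ.m≤n⇒m≤1+n (length-walk d u)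

  -- After the arguments of an atom have been read (`args`), the head returns to
  -- its relation symbol (`home`), collects the frames up to the left endmarker
  -- (`climb`), and returns to the position after the atom (`back`). The counters
  -- hold, in this order, the distance still to go back, the argument d of `walk`,
  -- the number of formulas to skip, and the argument slots.
  data State : Set where
    formula : Mode → State
    args    : Mode → RelSymbol S → Fin (suc m) → State
    home    : Mode → RelSymbol S → State
    climb   : Mode → RelSymbol S → Trend → Bindings (suc m) → State
    back    : Mode ⊎ Bool → State

  finite-State : Finite State
  finite-State = finite-↔ State↔
    (finite-⊎ finite-Mode (finite-⊎ (finite-× finite-Mode (finite-× (finite-Fin _) (finite-Fin _)))
    (finite-⊎ (finite-× finite-Mode (finite-Fin _))
    (finite-⊎ (finite-× finite-Mode (finite-× (finite-Fin _)
                (finite-× (finite-Maybe (finite-× finite-Bool finite-Bool)) finite-Bindings)))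
              (finite-⊎ finite-Mode finite-Bool)))))
    where
    finite-Mode : Finite Mode
    finite-Mode = finite-Maybe finite-Bool

    finite-Bindings : Finite (Bindings (suc m))
    finite-Bindings = finite-×
      (finite-Upto (finite-× finite-Quantifier (finite-Vec finite-Bool (suc m))) (suc m))
      (finite-Vec finite-Bool (suc m))

    State↔ : State ↔ (Mode ⊎ (Mode × RelSymbol S × Fin (suc m)) ⊎ (Mode × RelSymbol S) ⊎
                      (Mode × RelSymbol S × Trend × Bindings (suc m)) ⊎ (Mode ⊎ Bool))
    State↔ = mk↔ₛ′
      (λ { (formula μ) → inj₁ μ ; (args μ R r) → inj₂ (inj₁ (μ , R , r))
         ; (home μ R) → inj₂ (inj₂ (inj₁ (μ , R)))
         ; (climb μ R i bs) → inj₂ (inj₂ (inj₂ (inj₁ (μ , R , i , bs))))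
         ; (back n) → inj₂ (inj₂ (inj₂ (inj₂ n))) })
      (λ { (inj₁ μ) → formula μ ; (inj₂ (inj₁ (μ , R , r))) → args μ R r
         ; (inj₂ (inj₂ (inj₁ (μ , R)))) → home μ R
         ; (inj₂ (inj₂ (inj₂ (inj₁ (μ , R , i , bs))))) → climb μ R i bs
         ; (inj₂ (inj₂ (inj₂ (inj₂ n)))) → back n })
      (λ { (inj₁ μ) → refl ; (inj₂ (inj₁ (μ , R , r))) → refl
         ; (inj₂ (inj₂ (inj₁ (μ , R)))) → refl
         ; (inj₂ (inj₂ (inj₂ (inj₁ (μ , R , i , bs))))) → refl
         ; (inj₂ (inj₂ (inj₂ (inj₂ n)))) → refl })
      (λ { (formula μ) → refl ; (args μ R r) → refl ; (home μ R) → refl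
         ; (climb μ R i bs) → refl ; (back n) → refl })

  holds decs : Vec Op (suc m)
  holds = Vec.replicate (suc m) hold
  decs  = Vec.replicate (suc m) dec

  Command : Set
  Command = Bool ⊎ (State × Move × Vec Op (4 + m))

  formulaδ : Mode → InputCell (Symbol S) → Command
  formulaδ μ ⊢                    = inj₂ (formula μ , right , hold ∷ hold ∷ hold ∷ holds)
  formulaδ μ (sym and)            = inj₂ (formula μ , right , hold ∷ hold ∷ onSkip μ inc ∷ holds)
  formulaδ μ (sym or)             = inj₂ (formula μ , right , hold ∷ hold ∷ onSkip μ inc ∷ holds)
  formulaδ μ (sym (quantifier Q)) = inj₂ (formula μ , right , hold ∷ hold ∷ hold ∷ holds)
  formulaδ μ (sym (relation R))   =
    inj₂ (args μ R (clamp m (arity S R)) , right , hold ∷ hold ∷ onSkip μ dec ∷ holds)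
  formulaδ μ _                    = inj₁ false

  argsδ : Mode → RelSymbol S → ℕ → InputCell (Symbol S) → Command
  argsδ μ R zero    _            = inj₂ (home μ R , left , inc ∷ hold ∷ hold ∷ holds)
  argsδ μ R (suc r) (sym stroke) =
    inj₂ (args μ R (clamp m (suc r)) , right , hold ∷ hold ∷ hold ∷ incAt (clamp m r))
  argsδ μ R (suc r) (sym stop)   = inj₂ (args μ R (clamp m r) , right , hold ∷ hold ∷ hold ∷ holds)
  argsδ μ R (suc r) _            = inj₁ false

  homeδ : Mode → RelSymbol S → InputCell (Symbol S) → Command
  homeδ μ R (sym (relation _)) =
    inj₂ (climb μ R nothing (unbound (suc m)) , left , inc ∷ hold ∷ hold ∷ holds)
  homeδ μ R _                  = inj₂ (home μ R , left , inc ∷ hold ∷ hold ∷ holds)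

  -- If the count of finished formulas is positive, the connective takes one of them as left
  -- operand. Its right operand is another finished formula or the one at hand, and either way the
  -- count drops by one.
  connectiveδ : Bool → Mode → RelSymbol S → Trend → Bindings (suc m) → Bool → Command
  connectiveδ o μ R i bs true  = inj₂ (climb μ R (proj₁ (observe o i)) bs , left ,
                                       inc ∷ hold ∷ countOp μ (proj₂ (observe o i)) ∷ holds)
  connectiveδ o μ R i bs false = inj₂ (climb μ R i bs , left , inc ∷ dec ∷ hold ∷ holds)

  climbδ : Mode → RelSymbol S → Trend → Bindings (suc m) → InputCell (Symbol S) →
           Vec Bool (4 + m) → Command
  climbδ μ R i bs ⊢ (_ ∷ _ ∷ K₀ ∷ _) =
    if inScope (arity S R) (proj₂ bs)
    then inj₂ (back (decide μ i K₀ (atomValue R (proj₁ bs))) , stay , hold ∷ hold ∷ hold ∷ holds)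
    else inj₁ false
  climbδ μ R i bs (sym and) (_ ∷ D₀ ∷ _) = connectiveδ true μ R i bs D₀
  climbδ μ R i bs (sym or)  (_ ∷ D₀ ∷ _) = connectiveδ false μ R i bs D₀
  -- With no finished formula in between, the quantifier lies above the atom, and the zero tests of
  -- the slots are the vector that `bind` expects. Slots bound earlier remain at 0 and are masked by
  -- the record of unbound slots.
  climbδ μ R i bs (sym (quantifier Q)) (_ ∷ true ∷ _ ∷ zs) =
    inj₂ (climb μ R i (bind Q zs bs) , left , inc ∷ hold ∷ hold ∷ decs)
  climbδ μ R i bs (sym (relation _)) _ = inj₂ (climb μ R i bs , left , inc ∷ inc ∷ hold ∷ holds)
  climbδ μ R i bs _                  _ = inj₂ (climb μ R i bs , left , inc ∷ hold ∷ hold ∷ holds)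

  arriveδ : Mode ⊎ Bool → InputCell (Symbol S) → Command
  arriveδ (inj₁ μ) _ = inj₂ (formula μ , stay , hold ∷ hold ∷ hold ∷ holds)
  arriveδ (inj₂ v) ⊣ = inj₁ v
  arriveδ (inj₂ v) _ = inj₁ false

  -- The way back doubles as cleanup: no auxiliary counter exceeds the distance travelled, so
  -- decrementing at every step empties them all by the time of arrival.
  backδ : Mode ⊎ Bool → InputCell (Symbol S) → Vec Bool (4 + m) → Command
  backδ n c (true ∷ _)  = arriveδ n c
  backδ n c (false ∷ _) = inj₂ (back n , right , dec ∷ dec ∷ clearOp n ∷ decs)

  machine : CounterMachine (Symbol S)
  machine = record
    { State       = State
    ; #counters   = 4 + m
    ; inputFinite = finite-Symbol S
    ; stateFinite = finite-State
    ; start       = formula active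
    ; δ           = λ { (formula μ) c _ → formulaδ μ c
                      ; (args μ R r) c _ → argsδ μ R (toℕ r) c
                      ; (home μ R) c _ → homeδ μ R c
                      ; (climb μ R i bs) → climbδ μ R i bs
                      ; (back n) → backδ n }
    }
  open CounterMachine machine using (δ)
  open CounterRun machine

  -- The run of the program on a fixed input

  module Trace (W : Word) where

    N : ℕ
    N = suc (length W)

    Stops : State → ℕ → Vec ℕ (4 + m) → Bool → Set
    Stops q p ns b = Halts W N (config q p ns) b

    read-ʳ++ : ∀ (u v : Word) i → readInput (u ʳ++ v) (suc (length u + i)) ≡ readInput v (suc i)
    read-ʳ++ []      v i = refl
    read-ʳ++ (x ∷ u) v i =
      ≡.trans (cong (λ k → readInput (u ʳ++ (x ∷ v)) (suc k)) (≡.sym (ℕ.+-suc (length u) i)))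
              (read-ʳ++ u (x ∷ v) (suc i))

    read-at : ∀ u v → W ≡ u ʳ++ v → readInput W (suc (length u)) ≡ readInput v 1
    read-at u v refl = ≡.trans (cong (λ k → readInput W (suc k)) (≡.sym (ℕ.+-identityʳ (length u))))
                               (read-ʳ++ u v 0)

    length-W : ∀ u v → W ≡ u ʳ++ v → length W ≡ length u + length v
    length-W u v refl = List.length-ʳ++ u

    length≤ : ∀ u v → W ≡ u ʳ++ v → length u ≤ length W
    length≤ u v eq = subst (length u ≤_) (≡.sym (length-W u v eq)) (ℕ.m≤m+n (length u) (length v))

    right-from : ∀ {p} → p ≤ length W → moveInput W right p ≡ suc p
    right-from p≤ = ℕ.m≤n⇒m⊓n≡m (s≤s p≤)

    Bounded : Vec ℕ (4 + m) → Set
    Bounded = All (_≤ N)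

    move : ∀ {q p c P D K xs q′ mv o₁ o₂ o₃ os p′ xs′ b} →
      Bounded (P ∷ D ∷ K ∷ xs) → readInput W p ≡ c →
      δ q c (isZero P ∷ isZero D ∷ isZero K ∷ Vec.map isZero xs) ≡ inj₂ (q′ , mv , o₁ ∷ o₂ ∷ o₃ ∷ os) →
      moveInput W mv p ≡ p′ → Vec.zipWith applyOp os xs ≡ xs′ →
      Stops q′ p′ (applyOp o₁ P ∷ applyOp o₂ D ∷ applyOp o₃ K ∷ xs′) b → Stops q p (P ∷ D ∷ K ∷ xs) b
    move bd refl δ-eq refl refl h = next bd (cong (apply W _) δ-eq) h

    verdict : ∀ {q p c P D K xs b} → Bounded (P ∷ D ∷ K ∷ xs) → readInput W p ≡ c →
      δ q c (isZero P ∷ isZero D ∷ isZero K ∷ Vec.map isZero xs) ≡ inj₁ b →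
      Stops q p (P ∷ D ∷ K ∷ xs) b
    verdict bd refl δ-eq = halt bd (cong (apply W _) δ-eq)

    recount : ∀ {q p P P′ ns b} → P ≡ P′ → Stops q p (P ∷ ns) b → Stops q p (P′ ∷ ns) b
    recount refl h = h

    -- The part of the current atom already read. Coding it by Booleans guarantees that no relation
    -- symbol lies between the head and the one that `home` looks for.
    marks : List Bool → Word
    marks = List.map λ b → if b then stroke else stop

    home-run : ∀ a u v {μ R P K xs b} → W ≡ (marks a ++ relation R ∷ u) ʳ++ v →
      P + length (marks a ++ relation R ∷ u) ≤ N → K ≤ N → All (_≤ N) xs →
      Stops (climb μ R nothing (unbound (suc m))) (length u) (P + suc (length a) ∷ 0 ∷ K ∷ xs) b →
      Stops (home μ R) (length (marks a ++ relation R ∷ u)) (P ∷ 0 ∷ K ∷ xs) b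
    home-run [] u v {R = R} {P} {xs = xs} eq P≤ K≤ xs≤ h =
      move (ℕ.m+n≤o⇒m≤o P P≤ ∷ z≤n ∷ K≤ ∷ xs≤)
        (read-at u (relation R ∷ v) eq) refl refl (zipWith-hold xs)
        (recount (ℕ.+-comm P 1) h)
    home-run (c ∷ a) u v {μ} {R} {P} {K} {xs} {b} eq P≤ K≤ xs≤ h = first c eq
      where
      rest : W ≡ (marks (c ∷ a) ++ relation R ∷ u) ʳ++ v →
             Stops (home μ R) (length (marks a ++ relation R ∷ u)) (suc P ∷ 0 ∷ K ∷ xs) b
      rest eq = home-run a u _ eq (subst (_≤ N) (ℕ.+-suc P _) P≤) K≤ xs≤
        (recount (ℕ.+-suc P (suc (length a))) h)
      bd : Bounded (P ∷ 0 ∷ K ∷ xs)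
      bd = ℕ.m+n≤o⇒m≤o P P≤ ∷ z≤n ∷ K≤ ∷ xs≤
      first : ∀ d → W ≡ (marks (d ∷ a) ++ relation R ∷ u) ʳ++ v →
              Stops (home μ R) (suc (length (marks a ++ relation R ∷ u))) (P ∷ 0 ∷ K ∷ xs) b
      first true  eq′ = move bd
        (read-at (marks a ++ relation R ∷ u) (stroke ∷ v) eq′) refl refl (zipWith-hold xs) (rest eq)
      first false eq′ = move bd
        (read-at (marks a ++ relation R ∷ u) (stop ∷ v) eq′) refl refl (zipWith-hold xs) (rest eq)

    climb-bounded : ∀ {T P D K l xs} → T ≤ N → P + l ≡ T → D + l ≤ T → K ≤ T → All (_≤ T) xs →
                    Bounded (P ∷ D ∷ K ∷ xs)
    climb-bounded {P = P} {D} T≤ refl D≤ K≤ xs≤ =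
      ℕ.≤-trans (ℕ.m≤m+n P _) T≤ ∷ ℕ.≤-trans (ℕ.m+n≤o⇒m≤o D D≤) T≤ ∷ ℕ.≤-trans K≤ T≤ ∷
      All.map (λ x≤ → ℕ.≤-trans x≤ T≤) xs≤

    -- `T` is the position just after the atom; distance gone plus distance to the left endmarker
    -- always equals it. The skip count is bounded through its final value, as a scan never lowers
    -- it. The final `D′` and `xs′` are abstract because only their size matters for the way back.
    climb-run : ∀ u v {T P D K xs μ R i bs b} → W ≡ u ʳ++ v → T ≤ N → P + length u ≡ T →
      D + length u ≤ T → proj₂ (scan μ i K (walk D u)) ≤ T → All (_≤ T) xs →
      (∀ {D′ xs′} → D′ ≤ T → All (_≤ T) xs′ →
        Stops (climb μ R (proj₁ (scan μ i K (walk D u))) (bindAll (quants (walk D u)) xs bs)) 0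
              (T ∷ D′ ∷ proj₂ (scan μ i K (walk D u)) ∷ xs′) b) →
      Stops (climb μ R i bs) (length u) (P ∷ D ∷ K ∷ xs) b
    climb-run [] v {P = P} {D} eq T≤ P+ D≤ K≤ xs≤ h
      rewrite ≡.trans (≡.sym (ℕ.+-identityʳ P)) P+ = h (subst (_≤ _) (ℕ.+-identityʳ D) D≤) xs≤
    climb-run (and ∷ u) v {P = P} {zero} {K} {xs} {μ} {i = i} eq T≤ P+ D≤ K≤ xs≤ h =
      move (climb-bounded {P = P} T≤ P+ D≤ (ℕ.≤-trans (scan-≥ μ i K (walk zero (and ∷ u))) K≤) xs≤)
        (read-at u (and ∷ v) eq) refl refl (zipWith-hold xs)
        (climb-run u (and ∷ v) eq T≤ (≡.trans (≡.sym (ℕ.+-suc P _)) P+) (ℕ.<⇒≤ D≤) K≤ xs≤ h)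
    climb-run (and ∷ u) v {P = P} {suc D} {K} {xs} {μ} {i = i} eq T≤ P+ D≤ K≤ xs≤ h =
      move (climb-bounded {P = P} T≤ P+ D≤ (ℕ.≤-trans (scan-≥ μ i K (walk (suc D) (and ∷ u))) K≤) xs≤)
        (read-at u (and ∷ v) eq) refl refl (zipWith-hold xs)
        (climb-run u (and ∷ v) eq T≤ (≡.trans (≡.sym (ℕ.+-suc P _)) P+)
          (ℕ.≤-trans (ℕ.+-monoʳ-≤ D (ℕ.n≤1+n _)) (ℕ.<⇒≤ D≤)) K≤ xs≤ h)
    climb-run (or ∷ u) v {P = P} {zero} {K} {xs} {μ} {i = i} eq T≤ P+ D≤ K≤ xs≤ h =
      move (climb-bounded {P = P} T≤ P+ D≤ (ℕ.≤-trans (scan-≥ μ i K (walk zero (or ∷ u))) K≤) xs≤)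
        (read-at u (or ∷ v) eq) refl refl (zipWith-hold xs)
        (climb-run u (or ∷ v) eq T≤ (≡.trans (≡.sym (ℕ.+-suc P _)) P+) (ℕ.<⇒≤ D≤) K≤ xs≤ h)
    climb-run (or ∷ u) v {P = P} {suc D} {K} {xs} {μ} {i = i} eq T≤ P+ D≤ K≤ xs≤ h =
      move (climb-bounded {P = P} T≤ P+ D≤ (ℕ.≤-trans (scan-≥ μ i K (walk (suc D) (or ∷ u))) K≤) xs≤)
        (read-at u (or ∷ v) eq) refl refl (zipWith-hold xs)
        (climb-run u (or ∷ v) eq T≤ (≡.trans (≡.sym (ℕ.+-suc P _)) P+)
          (ℕ.≤-trans (ℕ.+-monoʳ-≤ D (ℕ.n≤1+n _)) (ℕ.<⇒≤ D≤)) K≤ xs≤ h)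
    climb-run (quantifier Q ∷ u) v {P = P} {zero} {K} {xs} {μ} {i = i} eq T≤ P+ D≤ K≤ xs≤ h =
      move (climb-bounded {P = P} T≤ P+ D≤
        (ℕ.≤-trans (scan-≥ μ i K (walk zero (quantifier Q ∷ u))) K≤) xs≤)
        (read-at u (quantifier Q ∷ v) eq) refl refl (zipWith-dec xs)
        (climb-run u (quantifier Q ∷ v) eq T≤ (≡.trans (≡.sym (ℕ.+-suc P _)) P+)
          (ℕ.<⇒≤ D≤) K≤ (all≤-pred (All.map ℕ.m≤n⇒m≤1+n xs≤)) h)
    climb-run (quantifier Q ∷ u) v {P = P} {suc D} {K} {xs} {μ} {i = i} eq T≤ P+ D≤ K≤ xs≤ h =
      move (climb-bounded {P = P} T≤ P+ D≤
        (ℕ.≤-trans (scan-≥ μ i K (walk (suc D) (quantifier Q ∷ u))) K≤) xs≤)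
        (read-at u (quantifier Q ∷ v) eq) refl refl (zipWith-hold xs)
        (climb-run u (quantifier Q ∷ v) eq T≤ (≡.trans (≡.sym (ℕ.+-suc P _)) P+)
          (ℕ.≤-trans (ℕ.+-monoʳ-≤ (suc D) (ℕ.n≤1+n _)) D≤) K≤ xs≤ h)
    climb-run (relation R′ ∷ u) v {P = P} {D} {K} {xs} {μ} {i = i} eq T≤ P+ D≤ K≤ xs≤ h =
      move (climb-bounded {P = P} T≤ P+ D≤
        (ℕ.≤-trans (scan-≥ μ i K (walk D (relation R′ ∷ u))) K≤) xs≤)
        (read-at u (relation R′ ∷ v) eq) refl refl (zipWith-hold xs)
        (climb-run u (relation R′ ∷ v) eq T≤ (≡.trans (≡.sym (ℕ.+-suc P _)) P+)
          (ℕ.≤-trans (ℕ.≤-reflexive (≡.sym (ℕ.+-suc D _))) D≤) K≤ xs≤ h)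
    climb-run (stroke ∷ u) v {P = P} {D} {K} {xs} {μ} {i = i} eq T≤ P+ D≤ K≤ xs≤ h =
      move (climb-bounded {P = P} T≤ P+ D≤ (ℕ.≤-trans (scan-≥ μ i K (walk D (stroke ∷ u))) K≤) xs≤)
        (read-at u (stroke ∷ v) eq) refl refl (zipWith-hold xs)
        (climb-run u (stroke ∷ v) eq T≤ (≡.trans (≡.sym (ℕ.+-suc P _)) P+)
          (ℕ.≤-trans (ℕ.+-monoʳ-≤ D (ℕ.n≤1+n _)) D≤) K≤ xs≤ h)
    climb-run (stop ∷ u) v {P = P} {D} {K} {xs} {μ} {i = i} eq T≤ P+ D≤ K≤ xs≤ h =
      move (climb-bounded {P = P} T≤ P+ D≤ (ℕ.≤-trans (scan-≥ μ i K (walk D (stop ∷ u))) K≤) xs≤)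
        (read-at u (stop ∷ v) eq) refl refl (zipWith-hold xs)
        (climb-run u (stop ∷ v) eq T≤ (≡.trans (≡.sym (ℕ.+-suc P _)) P+)
          (ℕ.≤-trans (ℕ.+-monoʳ-≤ D (ℕ.n≤1+n _)) D≤) K≤ xs≤ h)

    back-run : ∀ P n {pos D K xs b} → pos + P ≤ N → D ≤ P → K ≤ N → All (_≤ P) xs →
      Stops (back n) (pos + P) (0 ∷ 0 ∷ clear n P K ∷ zeros) b → Stops (back n) pos (P ∷ D ∷ K ∷ xs) b
    back-run zero n {pos} {zero} {K} pos≤ D≤ K≤ xs≤ h
      rewrite all≤0 xs≤ | ℕ.+-identityʳ pos | clear-zero n K = h
    back-run (suc P) n {pos} {D} {K} {xs} {b} pos≤ D≤ K≤ xs≤ h =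
      move (P≤ ∷ ℕ.≤-trans D≤ P≤ ∷ K≤ ∷ All.map (λ x≤ → ℕ.≤-trans x≤ P≤) xs≤)
        refl refl (right-from (ℕ.m+n≤o⇒m≤o pos pos+P≤)) (zipWith-dec xs)
        (back-run P n (s≤s pos+P≤) (ℕ.pred-mono-≤ D≤) (ℕ.≤-trans (clearOp-≤ n K) K≤) (all≤-pred xs≤)
          (subst (λ p → Stops (back n) p (0 ∷ 0 ∷ clear n P (applyOp (clearOp n) K) ∷ zeros) b) (ℕ.+-suc pos P)
            (subst (λ k → Stops (back n) (pos + suc P) (0 ∷ 0 ∷ k ∷ zeros) b) (clear-suc n P K) h)))
      where
      P≤ : suc P ≤ N
      P≤ = ℕ.m+n≤o⇒n≤o pos pos≤
      pos+P≤ : pos + P ≤ length W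
      pos+P≤ = ℕ.≤-pred (subst (_≤ N) (ℕ.+-suc pos P) pos≤)

    judge-bounded : ∀ {T D K xs} → T ≤ N → D ≤ T → K ≤ T → All (_≤ T) xs → Bounded (T ∷ D ∷ K ∷ xs)
    judge-bounded T≤ D≤ K≤ xs≤ =
      T≤ ∷ ℕ.≤-trans D≤ T≤ ∷ ℕ.≤-trans K≤ T≤ ∷ All.map (λ x≤ → ℕ.≤-trans x≤ T≤) xs≤

    judge-run : ∀ w {μ R i bs T D K xs Γ} → T ≤ N → D ≤ T → K ≤ T → All (_≤ T) xs →
      (∀ n → Stops (back n) T (0 ∷ 0 ∷ clear n T K ∷ zeros) (resume n Γ K w)) →
      Stops (climb μ R i bs) 0 (T ∷ D ∷ K ∷ xs)
        (if inScope (arity S R) (proj₂ bs)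
         then resume (decide μ i (isZero K) (atomValue R (proj₁ bs))) Γ K w else false)
    judge-run w {μ} {R} {i} {bs} {T} {D} {K} {xs} T≤ D≤ K≤ xs≤ h
      with inScope (arity S R) (proj₂ bs) in ok
    ... | false = verdict bd refl (if-false ok)
      where
      bd = judge-bounded T≤ D≤ K≤ xs≤
      if-false : ∀ {X : Set} {x y : X} {c} → c ≡ false → (if c then x else y) ≡ y
      if-false refl = refl
    ... | true  = move bd refl (if-true ok) refl (zipWith-hold xs)
                    (back-run T _ T≤ D≤ (ℕ.≤-trans K≤ T≤) xs≤ (h _))
      where
      bd = judge-bounded T≤ D≤ K≤ xs≤
      if-true : ∀ {X : Set} {x y : X} {c} → c ≡ true → (if c then x else y) ≡ x
      if-true refl = refl

    length-marks : ∀ a {R u} → length (marks a ++ relation R ∷ u) ≡ length a + suc (length u)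
    length-marks a = ≡.trans (List.length-++ (marks a)) (cong (_+ _) (List.length-map _ a))

    walk-marks : ∀ a {R u} → walk 0 (marks a ++ relation R ∷ u) ≡ pop (walk 0 u)
    walk-marks []          {u = u} = walk-suc 0 u
    walk-marks (true ∷ a)  = walk-marks a
    walk-marks (false ∷ a) = walk-marks a

    formula-bounded : ∀ w u μ {K} → W ≡ u ʳ++ w → ModeBound μ K (length u) →
                      Bounded (0 ∷ 0 ∷ K ∷ zeros)
    formula-bounded w u μ eq K-ok = z≤n ∷ z≤n ∷
      ℕ.≤-trans (modeBound-≤ μ K-ok) (ℕ.m≤n⇒m≤1+n (length≤ u w eq)) ∷ all≤-zeros (suc m)

    args-bounded : ∀ w a u μ {K R xs} → W ≡ (marks a ++ relation R ∷ u) ʳ++ w →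
                   ModeBound μ K (length u) → All (_≤ length a) xs → Bounded (0 ∷ 0 ∷ K ∷ xs)
    args-bounded w a u μ {R = R} eq K-ok xs≤ = z≤n ∷ z≤n ∷
      ℕ.≤-trans (modeBound-≤ μ K-ok) (ℕ.≤-trans (ℕ.n≤1+n _) (ℕ.≤-trans (ℕ.m≤n+m _ (length a)) total)) ∷
      All.map (λ x≤ → ℕ.≤-trans x≤ (ℕ.≤-trans (ℕ.m≤m+n _ (suc (length u))) total)) xs≤
      where
      total : length a + suc (length u) ≤ N
      total = subst (_≤ N) (length-marks a {R}) (ℕ.m≤n⇒m≤1+n (length≤ (marks a ++ relation R ∷ u) w eq))

    formula-run : ∀ w u μ K → W ≡ u ʳ++ w → ModeBound μ K (length u) →
      Stops (formula μ) (suc (length u)) (0 ∷ 0 ∷ K ∷ zeros) (runFormula (walk 0 u) μ K w)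
    args-run : ∀ w a u μ K R r xs → W ≡ (marks a ++ relation R ∷ u) ʳ++ w → r ≤ m →
      ModeBound μ K (length u) → All (_≤ length a) xs →
      Stops (args μ R (clamp m r)) (suc (length (marks a ++ relation R ∷ u))) (0 ∷ 0 ∷ K ∷ xs)
            (runArgs (walk 0 u) μ K R r xs w)
    arrive-run : ∀ w u n K {Γ} → W ≡ u ʳ++ w → walk 0 u ≡ Γ → K ≤ length u →
      Stops (back n) (suc (length u)) (0 ∷ 0 ∷ clear n (suc (length u)) K ∷ zeros) (resume n Γ K w)

    formula-run [] u μ K eq K-ok = verdict (formula-bounded [] u μ eq K-ok) (read-at u [] eq) refl
    formula-run (and ∷ w) u μ K eq K-ok =
      move (formula-bounded (and ∷ w) u μ eq K-ok) (read-at u (and ∷ w) eq) refl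
        (right-from (length≤ (and ∷ u) w eq)) (zipWith-hold zeros)
        (formula-run w (and ∷ u) μ _ eq (modeBound-inc μ K-ok))
    formula-run (or ∷ w) u μ K eq K-ok =
      move (formula-bounded (or ∷ w) u μ eq K-ok) (read-at u (or ∷ w) eq) refl
        (right-from (length≤ (or ∷ u) w eq)) (zipWith-hold zeros)
        (formula-run w (or ∷ u) μ _ eq (modeBound-inc μ K-ok))
    formula-run (quantifier Q ∷ w) u μ K eq K-ok =
      move (formula-bounded (quantifier Q ∷ w) u μ eq K-ok) (read-at u (quantifier Q ∷ w) eq) refl
        (right-from (length≤ (quantifier Q ∷ u) w eq)) (zipWith-hold zeros)
        (formula-run w (quantifier Q ∷ u) μ K eq (modeBound-suc μ K-ok))
    formula-run (relation R ∷ w) u μ K eq K-ok =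
      move (formula-bounded (relation R ∷ w) u μ eq K-ok) (read-at u (relation R ∷ w) eq) refl
        (right-from (length≤ (relation R ∷ u) w eq)) (zipWith-hold zeros)
        (args-run w [] u μ _ R (arity S R) zeros eq (arity≤ R) (modeBound-dec μ K-ok) (all≤-zeros (suc m)))
    formula-run (stroke ∷ w) u μ K eq K-ok =
      verdict (formula-bounded (stroke ∷ w) u μ eq K-ok) (read-at u (stroke ∷ w) eq) refl
    formula-run (stop ∷ w) u μ K eq K-ok =
      verdict (formula-bounded (stop ∷ w) u μ eq K-ok) (read-at u (stop ∷ w) eq) refl

    args-run w a u μ K R zero xs eq r≤ K-ok xs≤ =
      move {c = readInput W (suc (length u′))} bd refl refl refl (zipWith-hold xs)
        (home-run a u w eq (s≤s (length≤ u′ w eq)) K≤ xs≤N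
          (climb-run u (relation R ∷ (marks a ʳ++ w)) eq′ (s≤s (length≤ u′ w eq)) T≡
            (ℕ.≤-trans u≤ T≥) K′≤ xs≤T
            λ D′≤ xs′≤ → judge-run w (s≤s (length≤ u′ w eq)) D′≤ K′≤ xs′≤
              λ n → arrive-run w u′ n _ eq (walk-marks a) K″≤))
      where
      u′ : Word
      u′ = marks a ++ relation R ∷ u
      bd : Bounded (0 ∷ 0 ∷ K ∷ xs)
      bd = args-bounded w a u μ eq K-ok xs≤
      K≤ : K ≤ N
      K≤ = All.head (All.tail (All.tail bd))
      xs≤N : All (_≤ N) xs
      xs≤N = All.tail (All.tail (All.tail bd))
      eq′ : W ≡ u ʳ++ (relation R ∷ (marks a ʳ++ w))
      eq′ = ≡.trans eq (List.++-ʳ++ (marks a))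
      -- The distance on entering `climb`: one step back onto the atom, one for each mark and one
      -- past the relation symbol.
      T≡ : suc (suc (length a)) + length u ≡ suc (length u′)
      T≡ = cong suc (≡.trans (≡.sym (ℕ.+-suc (length a) (length u))) (≡.sym (length-marks a)))
      T≥ : suc (length a) + length u ≤ suc (length u′)
      T≥ = ℕ.≤-trans (ℕ.n≤1+n _) (ℕ.≤-reflexive T≡)
      u≤ : length u ≤ suc (length a) + length u
      u≤ = ℕ.m≤n+m (length u) (suc (length a))
      K-scan : proj₂ (scan μ nothing K (walk 0 u)) ≤ length u
      K-scan = scan-modeBound μ (walk 0 u) K-ok (length-walk 0 u)
      K′≤ : proj₂ (scan μ nothing K (walk 0 u)) ≤ suc (length u′)
      K′≤ = ℕ.≤-trans K-scan (ℕ.≤-trans u≤ T≥)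
      K″≤ : proj₂ (scan μ nothing K (walk 0 u)) ≤ length u′
      K″≤ = ℕ.≤-trans K-scan (ℕ.≤-trans u≤ (ℕ.≤-pred (ℕ.≤-reflexive T≡)))
      xs≤T : All (_≤ suc (length u′)) xs
      xs≤T = All.map (λ x≤ → ℕ.≤-trans x≤
        (ℕ.≤-trans (ℕ.≤-trans (ℕ.n≤1+n _) (ℕ.m≤m+n (suc (length a)) (length u))) T≥)) xs≤
    args-run [] a u μ K R (suc r) xs eq r< K-ok xs≤ =
      verdict (args-bounded [] a u μ eq K-ok xs≤) (read-at (marks a ++ relation R ∷ u) [] eq)
        (cong (λ k → argsδ μ R k ⊣) (toℕ-clamp r<))
    args-run (stroke ∷ w) a u μ K R (suc r) xs eq r< K-ok xs≤ =
      move (args-bounded (stroke ∷ w) a u μ eq K-ok xs≤)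
        (read-at (marks a ++ relation R ∷ u) (stroke ∷ w) eq)
        (cong (λ k → argsδ μ R k (sym stroke)) (toℕ-clamp r<))
        (right-from (length≤ (marks (true ∷ a) ++ relation R ∷ u) w eq)) (zipWith-incAt (clamp m r) xs)
        (args-run w (true ∷ a) u μ K R (suc r) _ eq r< K-ok (all≤-updateAt (clamp m r) xs≤))
    args-run (stop ∷ w) a u μ K R (suc r) xs eq r< K-ok xs≤ =
      move (args-bounded (stop ∷ w) a u μ eq K-ok xs≤)
        (read-at (marks a ++ relation R ∷ u) (stop ∷ w) eq)
        (cong (λ k → argsδ μ R k (sym stop)) (toℕ-clamp r<))
        (right-from (length≤ (marks (false ∷ a) ++ relation R ∷ u) w eq)) (zipWith-hold xs)
        (args-run w (false ∷ a) u μ K R r xs eq (ℕ.<⇒≤ r<) K-ok (All.map ℕ.m≤n⇒m≤1+n xs≤))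
    args-run (and ∷ w) a u μ K R (suc r) xs eq r< K-ok xs≤ =
      verdict (args-bounded (and ∷ w) a u μ eq K-ok xs≤)
        (read-at (marks a ++ relation R ∷ u) (and ∷ w) eq)
        (cong (λ k → argsδ μ R k (sym and)) (toℕ-clamp r<))
    args-run (or ∷ w) a u μ K R (suc r) xs eq r< K-ok xs≤ =
      verdict (args-bounded (or ∷ w) a u μ eq K-ok xs≤)
        (read-at (marks a ++ relation R ∷ u) (or ∷ w) eq)
        (cong (λ k → argsδ μ R k (sym or)) (toℕ-clamp r<))
    args-run (quantifier Q ∷ w) a u μ K R (suc r) xs eq r< K-ok xs≤ =
      verdict (args-bounded (quantifier Q ∷ w) a u μ eq K-ok xs≤)
        (read-at (marks a ++ relation R ∷ u) (quantifier Q ∷ w) eq)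
        (cong (λ k → argsδ μ R k (sym (quantifier Q))) (toℕ-clamp r<))
    args-run (relation R′ ∷ w) a u μ K R (suc r) xs eq r< K-ok xs≤ =
      verdict (args-bounded (relation R′ ∷ w) a u μ eq K-ok xs≤)
        (read-at (marks a ++ relation R ∷ u) (relation R′ ∷ w) eq)
        (cong (λ k → argsδ μ R k (sym (relation R′))) (toℕ-clamp r<))

    arrive-run w u (inj₁ active) K eq refl K≤
      rewrite ℕ.m≤n⇒m∸n≡0 (ℕ.m≤n⇒m≤1+n K≤) =
      move {q′ = formula active} (formula-bounded w u active eq refl) refl refl refl (zipWith-hold zeros)
        (formula-run w u active 0 eq refl)
    arrive-run w u (inj₁ (skip v)) K eq refl K≤ =
      move {q′ = formula (skip v)} (formula-bounded w u (skip v) eq K≤) refl refl refl (zipWith-hold zeros)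
        (formula-run w u (skip v) K eq K≤)
    arrive-run []      u (inj₂ v) K eq _ K≤ = verdict (formula-bounded [] u (skip v) eq K≤)
      (read-at u [] eq) refl
    arrive-run (x ∷ w) u (inj₂ v) K eq _ K≤ =
      verdict (formula-bounded (x ∷ w) u (skip v) eq K≤) (read-at u (x ∷ w) eq) refl

    run-halts : Halts W N initial (runFormula [] active 0 W)
    run-halts = move (all≤-zeros (4 + m)) refl refl (right-from z≤n) (zipWith-hold zeros)
      (formula-run W [] active 0 refl refl)

bounded-above : ∀ n (f : Fin n → ℕ) → ∃[ m ] (∀ i → f i ≤ m)
bounded-above zero    f = 0 , λ ()
bounded-above (suc n) f with bounded-above n (f ∘ suc)
... | m , f≤ = f zero ⊔ m , λ { zero → ℕ.m≤m⊔n (f zero) m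
                              ; (suc i) → ℕ.≤-trans (f≤ i) (ℕ.m≤n⊔m (f zero) m) }

lemma5 : ∀ {ℓ} → ExcludedMiddle ℓ →
    (S : Signature) (B : Structure S ℓ) →
    ¬ ∃ (λ φ → Breaks∧ B φ) →
    ¬ ∃ (λ ψ → Breaks∨ B ψ) →
    InLogspace (MC B)
lemma5 em S B ¬breaks∧ ¬breaks∨ with bounded-above (size S) (arity S)
... | m , arity≤ = inLogspace machine (MC B) λ w →
  runFormula [] active 0 w , Trace.run-halts w , correct w _ refl
  where
  open Semantics em S B
  open Valuation S m atomValue using (val)
  open Recognition S m arity≤ atomValue
  open Program S m arity≤ atomValue

  val-correct : ∀ θ → Reflects (B ⊨ θ) (val [] θ)
  val-correct = val-reflects arity≤ ¬breaks∧ ¬breaks∨ []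

  -- Syntax and truth are settled separately: acceptance already yields a sentence encoded by `w`,
  -- and on encodings the run computes `val`, which decides truth. A rejected word may be ill-formed
  -- or false, and assuming an encoding of a true sentence contradicts both at once.
  correct : ∀ w b → runFormula [] active 0 w ≡ b → Reflects (MC B w) b
  correct w true eq with accepted-sentence w eq
  ... | θ , refl = ofʸ (θ , refl , invert (subst (Reflects (B ⊨ θ))
                     (≡.trans (≡.sym (runFormula-encode θ)) eq) (val-correct θ)))
  correct w false eq = ofⁿ λ { (θ , refl , sat) →
    invert (subst (Reflects (B ⊨ θ)) (≡.trans (≡.sym (runFormula-encode θ)) eq) (val-correct θ)) sat }
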